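{- Let $G=C_n$ be a circular graph with $n\ge 4$, let $G_m$ be its barycentric refinements, and let $T(x)=4x-x^2$. Then for every $m\ge 0$ the matrix $T(L(G_{m+1}))=4L(G_{m+1})-L(G_{m+1})^2$ has an invariant subspace of half the dimension (i.e. of dimension equal to the number of vertices of $G_m$) such that the restriction of $T(L(G_{m+1}))$ to this subspace is, in a suitable basis, the matrix $L(G_m)$. Moreover, the quadratic map $T$ has Julia set $[0,4]$.
   Context: The circular graph $C_n$ is the cycle graph with $n$ vertices. The barycentric refinement $G_1$ of a finite simple graph $G$ is the graph whose vertices are the non-empty complete subgraphs of $G$, two distinct ones being adjacent if one is contained in the other; $G_0=G$ and $G_{m+1}$ is the barycentric refinement of $G_m$ (for $G=C_n$ with $n\ge4$, $G_m$ is the cycle $C_{2^m n}$). $L(G)=B-A$ is the Laplacian of $G$, with $A$ the adjacency matrix and $B$ the diagonal degree matrix. -}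

module Defs where

open import Algebra.Bundles using (RawRing)
import Algebra.Definitions.RawMonoid as RawMonoidDefs
open import Data.Fin.Base using (Fin; toℕ)
open import Data.Fin.Properties using (all?; toℕ<n) renaming (_≟_ to _≟ᶠ_)
open import Data.Fin.Subset using (Subset; inside; outside; Nonempty; _∈_; _⊆_)
open import Data.Fin.Subset.Properties using (nonempty?; _∈?_; _⊆?_)
open import Data.Bool.Properties using () renaming (_≟_ to _≟ᵇ_)
open import Data.Integer.Base using (+_)
open import Data.List.Base using (List; []; _∷_; _++_; map; filter; length; lookup)
open import Data.Nat.Base as ℕ using (ℕ; zero; suc; _%_)
import Data.Nat.DivMod as ℕ
open import Data.Nat.GeneralisedArithmetic using (iterate)
import Data.Nat.Properties as ℕ
open import Data.Product.Base using (_×_; _,_; ∃-syntax)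
open import Data.Rational.Base as ℚ using (ℚ; 0ℚ; 1ℚ; ½; ∣_∣)
import Data.Rational.Properties as ℚ
open import Data.Rational.Solver using (module +-*-Solver)
open import Data.Sum.Base using (_⊎_; inj₁; inj₂; swap)
open import Data.Vec.Base as Vec using ([]; _∷_)
import Data.Vec.Properties as Vec
open import Data.Vec.Functional using (Vector)
open import Function.Base using (_∘_)
open import Level using (0ℓ)
open import Relation.Binary.Core using (Rel)
open import Relation.Binary.Definitions using (Decidable; Symmetric; Irreflexive)
open import Relation.Binary.PropositionalEquality
  using (_≡_; _≢_; refl; sym; trans; cong; subst)
open import Relation.Nullary using (¬_; yes; no; contradiction)
open import Relation.Nullary.Decidable using (_×-dec_; _⊎-dec_; _→-dec_; ¬?)
open import Relation.Unary as Unary using (Pred)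

record Graph : Set₁ where
  field
    size  : ℕ
    Adj   : Rel (Fin size) 0ℓ
    adj?  : Decidable Adj
    symm  : Symmetric Adj
    irrefl : Irreflexive _≡_ Adj

  degree : Fin size → ℕ
  degree i = Vec.count (adj? i) (Vec.allFin size)

open Graph public

cycle : ∀ n → 3 ℕ.≤ n → Graph
cycle n n≥3 = record
  { size   = n
  ; Adj    = λ i j → next i ≡ toℕ j ⊎ next j ≡ toℕ i
  ; adj?   = λ i j → (next i ℕ.≟ toℕ j) ⊎-dec (next j ℕ.≟ toℕ i)
  ; symm   = swap
  ; irrefl = λ { refl (inj₁ p) → next≢ _ p ; refl (inj₂ p) → next≢ _ p }
  }
  where
  instance
    n≢0 : ℕ.NonZero n
    n≢0 = ℕ.>-nonZero (ℕ.≤-trans (ℕ.s≤s ℕ.z≤n) n≥3)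

  next : Fin n → ℕ
  next i = suc (toℕ i) % n

  next≢ : ∀ i → next i ≢ toℕ i
  next≢ i p with ℕ.m≤n⇒m<n∨m≡n (toℕ<n i)
  ... | inj₁ 1+i<n = ℕ.1+n≢n (trans (sym (ℕ.m<n⇒m%n≡m 1+i<n)) p)
  ... | inj₂ 1+i≡n = ℕ.<⇒≢ (ℕ.≤-trans (ℕ.s≤s (ℕ.s≤s ℕ.z≤n)) n≥3) (trans (cong suc 0≡i) 1+i≡n)
    where
    0≡i : 0 ≡ toℕ i
    0≡i = trans (sym (ℕ.n%n≡0 n)) (trans (cong (_% n) (sym 1+i≡n)) p)

-- Lists each subset once, so that the refinement has no repeated vertices.
subsets : ∀ n → List (Subset n)
subsets zero    = [] ∷ []
subsets (suc n) = map (inside ∷_) (subsets n) ++ map (outside ∷_) (subsets n)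

module _ (G : Graph) where

  Clique : Pred (Subset (size G)) 0ℓ
  Clique s = Nonempty s × (∀ x y → x ∈ s → y ∈ s → x ≢ y → Adj G x y)

  clique? : Unary.Decidable Clique
  clique? s = nonempty? s ×-dec
    all? (λ x → all? (λ y →
      (x ∈? s) →-dec ((y ∈? s) →-dec (¬? (x ≟ᶠ y) →-dec adj? G x y))))

  cliques : List (Subset (size G))
  cliques = filter clique? (subsets (size G))

  refinement : Graph
  refinement = record
    { size   = length cliques
    ; Adj    = λ i j → σ i ≢ σ j × (σ i ⊆ σ j ⊎ σ j ⊆ σ i)
    ; adj?   = λ i j → ¬? (Vec.≡-dec _≟ᵇ_ (σ i) (σ j))
                         ×-dec ((σ i ⊆? σ j) ⊎-dec (σ j ⊆? σ i))
    ; symm   = λ (σi≢σj , c) → (λ eq → σi≢σj (sym eq)) , swap c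
    ; irrefl = λ { refl (σi≢σi , _) → σi≢σi refl }
    }
    where
    σ : Fin (length cliques) → Subset (size G)
    σ = lookup cliques

barycentric : Graph → ℕ → Graph
barycentric G zero    = G
barycentric G (suc m) = refinement (barycentric G m)

IsCauchy : (ℕ → ℚ) → Set
IsCauchy x = ∀ ε → 0ℚ ℚ.< ε →
  ∃[ N ] ∀ m n → N ℕ.≤ m → N ℕ.≤ n → ∣ x m ℚ.- x n ∣ ℚ.< ε

-- Equality of reals is _≈_ below, not propositional equality.
record ℝ : Set where
  constructor mkℝ
  field
    seq    : ℕ → ℚ
    cauchy : IsCauchy seq

open ℝ public

infix 4 _≈_ _≤_ _<_
infixl 6 _+_
infixl 7 _*_
infix  8 -_

_≈_ : Rel ℝ 0ℓ
x ≈ y = ∀ ε → 0ℚ ℚ.< ε → ∃[ N ] ∀ n → N ℕ.≤ n → ∣ seq x n ℚ.- seq y n ∣ ℚ.< ε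

_≤_ : Rel ℝ 0ℓ
x ≤ y = ∀ ε → 0ℚ ℚ.< ε → ∃[ N ] ∀ n → N ℕ.≤ n → seq x n ℚ.< seq y n ℚ.+ ε

_<_ : Rel ℝ 0ℓ
x < y = ∃[ ε ] 0ℚ ℚ.< ε × ∃[ N ] ∀ n → N ℕ.≤ n → seq x n ℚ.+ ε ℚ.< seq y n

-- Abstract, because unfolding these proofs makes type checking prohibitively slow.
abstract

  const-cauchy : ∀ q → IsCauchy (λ _ → q)
  const-cauchy q ε 0<ε = 0 , λ _ _ _ _ →
    subst (ℚ._< ε) (sym (cong ∣_∣ (ℚ.+-inverseʳ q))) 0<ε

  neg-cauchy : ∀ x → IsCauchy (λ n → ℚ.- seq x n)
  neg-cauchy x ε 0<ε =
    let N , close = cauchy x ε 0<ε in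
    N , λ m n N≤m N≤n → subst (ℚ._< ε) (flip≡ (seq x m) (seq x n)) (close m n N≤m N≤n)
    where
    flip≡ : ∀ a b → ∣ a ℚ.- b ∣ ≡ ∣ ℚ.- a ℚ.- (ℚ.- b) ∣
    flip≡ a b = trans (sym (ℚ.∣-p∣≡∣p∣ (a ℚ.- b)))
      (cong ∣_∣ (solve 2 (λ a b → :- (a :- b) := :- a :- (:- b)) refl a b))
      where open +-*-Solver

  +-cauchy : ∀ x y → IsCauchy (λ n → seq x n ℚ.+ seq y n)
  +-cauchy x y ε 0<ε =
    let M , x-close = cauchy x (½ ℚ.* ε) 0<½ε
        N , y-close = cauchy y (½ ℚ.* ε) 0<½ε
    in M ℕ.⊔ N , λ m n ≤m ≤n → sum-close {seq x m} {seq y m} {seq x n} {seq y n}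
         (x-close m n (ℕ.m⊔n≤o⇒m≤o M N ≤m) (ℕ.m⊔n≤o⇒m≤o M N ≤n))
         (y-close m n (ℕ.m⊔n≤o⇒n≤o M N ≤m) (ℕ.m⊔n≤o⇒n≤o M N ≤n))
    where
    open ℚ.≤-Reasoning

    0<½ε : 0ℚ ℚ.< ½ ℚ.* ε
    0<½ε = ℚ.positive⁻¹ (½ ℚ.* ε) {{ℚ.pos*pos⇒pos ½ ε {{ℚ.positive 0<ε}}}}

    rearrange : ∀ a b c d → (a ℚ.- c) ℚ.+ (b ℚ.- d) ≡ (a ℚ.+ b) ℚ.- (c ℚ.+ d)
    rearrange = solve 4 (λ a b c d → (a :- c) :+ (b :- d) := (a :+ b) :- (c :+ d)) refl
      where open +-*-Solver

    ½+½≡1 : ½ ℚ.+ ½ ≡ 1ℚ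
    ½+½≡1 = refl

    sum-close : ∀ {a b c d} → ∣ a ℚ.- c ∣ ℚ.< ½ ℚ.* ε → ∣ b ℚ.- d ∣ ℚ.< ½ ℚ.* ε →
      ∣ (a ℚ.+ b) ℚ.- (c ℚ.+ d) ∣ ℚ.< ε
    sum-close {a} {b} {c} {d} a-c<½ε b-d<½ε = begin-strict
      ∣ (a ℚ.+ b) ℚ.- (c ℚ.+ d) ∣  ≡⟨ cong ∣_∣ (rearrange a b c d) ⟨
      ∣ (a ℚ.- c) ℚ.+ (b ℚ.- d) ∣  ≤⟨ ℚ.∣p+q∣≤∣p∣+∣q∣ (a ℚ.- c) (b ℚ.- d) ⟩
      ∣ a ℚ.- c ∣ ℚ.+ ∣ b ℚ.- d ∣  <⟨ ℚ.+-mono-< {∣ a ℚ.- c ∣} {½ ℚ.* ε} {∣ b ℚ.- d ∣} {½ ℚ.* ε} a-c<½ε b-d<½ε ⟩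
      ½ ℚ.* ε ℚ.+ ½ ℚ.* ε          ≡⟨ ℚ.*-distribʳ-+ ε ½ ½ ⟨
      (½ ℚ.+ ½) ℚ.* ε              ≡⟨ cong (ℚ._* ε) ½+½≡1 ⟩
      1ℚ ℚ.* ε                     ≡⟨ ℚ.*-identityˡ ε ⟩
      ε                            ∎

  eventuallyBounded : ∀ x → ∃[ B ] 0ℚ ℚ.< B × ∃[ N ] ∀ n → N ℕ.≤ n → ∣ seq x n ∣ ℚ.≤ B
  eventuallyBounded x with cauchy x 1ℚ (ℚ.positive⁻¹ 1ℚ)
  ... | N , close = 1ℚ ℚ.+ ∣ seq x N ∣
    , ℚ.+-mono-<-≤ (ℚ.positive⁻¹ 1ℚ) (ℚ.0≤∣p∣ (seq x N))
    , N , λ n N≤n → begin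
      ∣ seq x n ∣                             ≡⟨ cong ∣_∣ (split (seq x n) (seq x N)) ⟩
      ∣ (seq x n ℚ.- seq x N) ℚ.+ seq x N ∣   ≤⟨ ℚ.∣p+q∣≤∣p∣+∣q∣ (seq x n ℚ.- seq x N) (seq x N) ⟩
      ∣ seq x n ℚ.- seq x N ∣ ℚ.+ ∣ seq x N ∣ ≤⟨ ℚ.+-monoˡ-≤ ∣ seq x N ∣ (ℚ.<⇒≤ (close n N N≤n ℕ.≤-refl)) ⟩
      1ℚ ℚ.+ ∣ seq x N ∣                      ∎
    where
    open ℚ.≤-Reasoning
    split : ∀ a b → a ≡ (a ℚ.- b) ℚ.+ b
    split = solve 2 (λ a b → a := (a :- b) :+ b) refl
      where open +-*-Solver

  *-cauchy : ∀ x y → IsCauchy (λ n → seq x n ℚ.* seq y n)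
  *-cauchy x y ε 0<ε =
    let B , 0<B , M₁ , x≤B = eventuallyBounded x
        C , 0<C , N₁ , y≤C = eventuallyBounded y
        δ , 0<δ , [B+C]δ≡ε = divide (B ℚ.+ C) ε (ℚ.+-mono-< {0ℚ} {B} {0ℚ} {C} 0<B 0<C) 0<ε
        M₂ , x-close       = cauchy x δ 0<δ
        N₂ , y-close       = cauchy y δ 0<δ
    in (M₁ ℕ.⊔ N₁) ℕ.⊔ (M₂ ℕ.⊔ N₂) , λ m n ≤m ≤n →
    let ≤m₂ = ℕ.m⊔n≤o⇒n≤o (M₁ ℕ.⊔ N₁) (M₂ ℕ.⊔ N₂) ≤m
        ≤n₂ = ℕ.m⊔n≤o⇒n≤o (M₁ ℕ.⊔ N₁) (M₂ ℕ.⊔ N₂) ≤n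
    in subst (∣ seq x m ℚ.* seq y m ℚ.- seq x n ℚ.* seq y n ∣ ℚ.<_) [B+C]δ≡ε
         (product-close {seq x m} {seq y m} {seq x n} {seq y n} {B} {C} {δ} 0<B 0<C
           (x≤B m (ℕ.m⊔n≤o⇒m≤o M₁ N₁ (ℕ.m⊔n≤o⇒m≤o (M₁ ℕ.⊔ N₁) (M₂ ℕ.⊔ N₂) ≤m)))
           (y≤C n (ℕ.m⊔n≤o⇒n≤o M₁ N₁ (ℕ.m⊔n≤o⇒m≤o (M₁ ℕ.⊔ N₁) (M₂ ℕ.⊔ N₂) ≤n)))
           (x-close m n (ℕ.m⊔n≤o⇒m≤o M₂ N₂ ≤m₂) (ℕ.m⊔n≤o⇒m≤o M₂ N₂ ≤n₂))
           (y-close m n (ℕ.m⊔n≤o⇒n≤o M₂ N₂ ≤m₂) (ℕ.m⊔n≤o⇒n≤o M₂ N₂ ≤n₂)))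
    where
    rearrange : ∀ a b c d → a ℚ.* (b ℚ.- d) ℚ.+ (a ℚ.- c) ℚ.* d ≡ a ℚ.* b ℚ.- c ℚ.* d
    rearrange = solve 4 (λ a b c d → a :* (b :- d) :+ (a :- c) :* d := a :* b :- c :* d) refl
      where open +-*-Solver

    product-bound : ∀ p q {B δ} → 0ℚ ℚ.< B → ∣ p ∣ ℚ.≤ B → ∣ q ∣ ℚ.< δ → ∣ p ℚ.* q ∣ ℚ.< B ℚ.* δ
    product-bound p q {B} {δ} 0<B p≤B q<δ = begin-strict
      ∣ p ℚ.* q ∣       ≡⟨ ℚ.∣p*q∣≡∣p∣*∣q∣ p q ⟩
      ∣ p ∣ ℚ.* ∣ q ∣   ≤⟨ ℚ.*-monoʳ-≤-nonNeg ∣ q ∣ {{ℚ.∣-∣-nonNeg q}} p≤B ⟩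
      B ℚ.* ∣ q ∣       <⟨ ℚ.*-monoʳ-<-pos B {{ℚ.positive 0<B}} q<δ ⟩
      B ℚ.* δ           ∎
      where open ℚ.≤-Reasoning

    divide : ∀ K ε → 0ℚ ℚ.< K → 0ℚ ℚ.< ε → ∃[ δ ] 0ℚ ℚ.< δ × K ℚ.* δ ≡ ε
    divide K ε 0<K 0<ε = K⁻¹ ℚ.* ε , ℚ.positive⁻¹ (K⁻¹ ℚ.* ε) {{ℚ.pos*pos⇒pos K⁻¹ ε}}
      , trans (sym (ℚ.*-assoc K K⁻¹ ε)) (trans (cong (ℚ._* ε) (ℚ.*-inverseʳ K)) (ℚ.*-identityˡ ε))
      where
      instance
        K-pos : ℚ.Positive K
        K-pos = ℚ.positive 0<K
        K-nonZero : ℚ.NonZero K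
        K-nonZero = ℚ.pos⇒nonZero K
        ε-pos : ℚ.Positive ε
        ε-pos = ℚ.positive 0<ε
      K⁻¹ : ℚ
      K⁻¹ = ℚ.1/ K
      instance
        K⁻¹-pos : ℚ.Positive K⁻¹
        K⁻¹-pos = ℚ.1/pos⇒pos K

    product-close : ∀ {a b c d B C δ} → 0ℚ ℚ.< B → 0ℚ ℚ.< C → ∣ a ∣ ℚ.≤ B → ∣ d ∣ ℚ.≤ C →
      ∣ a ℚ.- c ∣ ℚ.< δ → ∣ b ℚ.- d ∣ ℚ.< δ → ∣ a ℚ.* b ℚ.- c ℚ.* d ∣ ℚ.< (B ℚ.+ C) ℚ.* δ
    product-close {a} {b} {c} {d} {B} {C} {δ} 0<B 0<C a≤B d≤C a-c<δ b-d<δ = begin-strict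
      ∣ a ℚ.* b ℚ.- c ℚ.* d ∣  ≡⟨ cong ∣_∣ (rearrange a b c d) ⟨
      ∣ p ℚ.+ q ∣              ≤⟨ ℚ.∣p+q∣≤∣p∣+∣q∣ p q ⟩
      ∣ p ∣ ℚ.+ ∣ q ∣          <⟨ ℚ.+-mono-< {∣ p ∣} {B ℚ.* δ} {∣ q ∣} {C ℚ.* δ} p<Bδ q<Cδ ⟩
      B ℚ.* δ ℚ.+ C ℚ.* δ      ≡⟨ ℚ.*-distribʳ-+ δ B C ⟨
      (B ℚ.+ C) ℚ.* δ          ∎
      where
      open ℚ.≤-Reasoning
      p q : ℚ
      p = a ℚ.* (b ℚ.- d)
      q = (a ℚ.- c) ℚ.* d
      p<Bδ : ∣ p ∣ ℚ.< B ℚ.* δ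
      p<Bδ = product-bound a (b ℚ.- d) 0<B a≤B b-d<δ
      q<Cδ : ∣ q ∣ ℚ.< C ℚ.* δ
      q<Cδ = subst (λ r → ∣ r ∣ ℚ.< C ℚ.* δ) (ℚ.*-comm d (a ℚ.- c))
        (product-bound d (a ℚ.- c) 0<C d≤C a-c<δ)

fromℚ : ℚ → ℝ
fromℚ q = mkℝ (λ _ → q) (const-cauchy q)

fromℕ : ℕ → ℝ
fromℕ n = fromℚ (+ n ℚ./ 1)

-_ : ℝ → ℝ
- x = mkℝ (λ n → ℚ.- seq x n) (neg-cauchy x)

_+_ : ℝ → ℝ → ℝ
x + y = mkℝ (λ n → seq x n ℚ.+ seq y n) (+-cauchy x y)

_*_ : ℝ → ℝ → ℝ
x * y = mkℝ (λ n → seq x n ℚ.* seq y n) (*-cauchy x y)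

ℝ-rawRing : RawRing 0ℓ 0ℓ
ℝ-rawRing = record
  { Carrier = ℝ ; _≈_ = _≈_ ; _+_ = _+_ ; _*_ = _*_ ; -_ = -_
  ; 0# = fromℕ 0 ; 1# = fromℕ 1 }

sum : ∀ {n} → Vector ℝ n → ℝ
sum = RawMonoidDefs.sum (RawRing.+-rawMonoid ℝ-rawRing)

infix 4 _≈ᵛ_

_≈ᵛ_ : ∀ {n} → Rel (Vector ℝ n) 0ℓ
u ≈ᵛ v = ∀ i → u i ≈ v i

linComb : ∀ {n d} → Vector ℝ d → Vector (Vector ℝ n) d → Vector ℝ n
linComb c b k = sum (λ i → c i * b i k)

Matrix : ℕ → Set
Matrix n = Fin n → Fin n → ℝ

infixr 7 _·_

_·_ : ∀ {n} → Matrix n → Vector ℝ n → Vector ℝ n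
(M · v) i = sum (λ j → M i j * v j)

identity : ∀ n → Matrix n
identity n i j with i ≟ᶠ j
... | yes _ = fromℕ 1
... | no  _ = fromℕ 0

matrixRawRing : ℕ → RawRing 0ℓ 0ℓ
matrixRawRing n = record
  { Carrier = Matrix n
  ; _≈_ = λ M N → ∀ i j → M i j ≈ N i j
  ; _+_ = λ M N i j → M i j + N i j
  ; _*_ = λ M N i j → sum (λ k → M i k * N k j)
  ; -_  = λ M i j → - M i j
  ; 0#  = λ _ _ → fromℕ 0
  ; 1#  = identity n
  }

record Subspace (n : ℕ) : Set₁ where
  field
    Member   : Pred (Vector ℝ n) 0ℓ
    resp     : ∀ {u v} → u ≈ᵛ v → Member u → Member v
    0-closed : Member (λ _ → fromℕ 0)
    +-closed : ∀ {u v} → Member u → Member v → Member (λ i → u i + v i)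
    ·-closed : ∀ c {v} → Member v → Member (λ i → c * v i)

open Subspace public

Invariant : ∀ {n} → Matrix n → Subspace n → Set
Invariant M S = ∀ {v} → Member S v → Member S (M · v)

-- Since d is part of the type, a basis also fixes the dimension of S as d.
record IsBasis {n d} (S : Subspace n) (b : Vector (Vector ℝ n) d) : Set where
  field
    member      : ∀ i → Member S (b i)
    spanning    : ∀ {v} → Member S v → ∃[ c ] v ≈ᵛ linComb c b
    independent : ∀ c → linComb c b ≈ᵛ (λ _ → fromℕ 0) → ∀ i → c i ≈ fromℕ 0

-- In the basis b, column j of N holds the coordinates of M · b j.
RestrictsTo : ∀ {n d} → Matrix n → Vector (Vector ℝ n) d → Matrix d → Set
RestrictsTo M b N = ∀ j → M · b j ≈ᵛ linComb (λ i → N i j) b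

module _ (G : Graph) where

  adjacencyMatrix : Matrix (size G)
  adjacencyMatrix i j with adj? G i j
  ... | yes _ = fromℕ 1
  ... | no  _ = fromℕ 0

  degreeMatrix : Matrix (size G)
  degreeMatrix i j with i ≟ᶠ j
  ... | yes _ = fromℕ (degree G i)
  ... | no  _ = fromℕ 0

  laplacian : Matrix (size G)
  laplacian i j = degreeMatrix i j + - adjacencyMatrix i j

module _ {c ℓ} (R : RawRing c ℓ) where
  private
    module R = RawRing R
    module +R = RawMonoidDefs R.+-rawMonoid

  T : R.Carrier → R.Carrier
  T x = (4 +R.× x) R.+ (R.- (x R.* x))

record ℂ : Set where
  constructor _+i_
  field
    re im : ℝ

open ℂ public

ℂ-rawRing : RawRing 0ℓ 0ℓ
ℂ-rawRing = record
  { Carrier = ℂ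
  ; _≈_ = λ z w → re z ≈ re w × im z ≈ im w
  ; _+_ = λ z w → (re z + re w) +i (im z + im w)
  ; _*_ = λ z w → (re z * re w + - (im z * im w)) +i (re z * im w + im z * re w)
  ; -_  = λ z → (- re z) +i (- im z)
  ; 0#  = fromℕ 0 +i fromℕ 0
  ; 1#  = fromℕ 1 +i fromℕ 0
  }

distance² : ℂ → ℂ → ℝ
distance² z w = (re z + - re w) * (re z + - re w) + (im z + - im w) * (im z + - im w)

-- Both distances below are compared through their squares, which spares the
-- square root.

FilledJulia : (ℂ → ℂ) → Pred ℂ 0ℓ
FilledJulia f z = ∃[ r ] ∀ k → distance² (iterate f z k) (fromℕ 0 +i fromℕ 0) ≤ r * r

Boundary : Pred ℂ 0ℓ → Pred ℂ 0ℓ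
Boundary P z = ∀ r → fromℕ 0 < r →
  (∃[ w ] distance² w z < r * r × P w) × (∃[ w ] distance² w z < r * r × ¬ P w)

-- The Julia set of a polynomial map of degree at least 2: the boundary of the
-- set of points with bounded orbit.
Julia : (ℂ → ℂ) → Pred ℂ 0ℓ
Julia f = Boundary (FilledJulia f)

realInterval : ℝ → ℝ → Pred ℂ 0ℓ
realInterval a b z = im z ≈ fromℕ 0 × a ≤ re z × re z ≤ b

-- Let s be the shift along a cycle, so that L = 2 − (s + s⁻¹) and
-- T(L) = 4 − (2 − L)² = 2 − (s² + s⁻²). The refinement of a cycle alternates between
-- its vertices and its edges, so s² of the refinement is s of the original cycle on
-- the vertices: the vectors supported there form the invariant subspace.
--
-- With u = 2 − z the map T becomes u ↦ u² − 2, which sends the exterior of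
-- an ellipse with foci ±2 to the exterior of a larger confocal one. The ellipses grow
-- without bound, so orbits starting off [0,4] are unbounded, while those starting in
-- [0,4] stay there. All estimates are made on the rational terms of the representing
-- sequences, and nearby points of the filled Julia set are taken rational.

module Submission where

open import Defs
open import Algebra.Bundles using (CommutativeRing)
import Algebra.Properties.CommutativeMonoid.Sum as CommutativeMonoidSum
import Algebra.Properties.Semiring.Sum as SemiringSum
open import Data.Bool.Base using (if_then_else_)
open import Data.Empty using (⊥-elim)
open import Data.Fin.Base using (Fin; zero; suc; toℕ; fromℕ<)
open import Data.Fin.Permutation using (↔⇒≡)
open import Data.Fin.Properties
  using (toℕ-injective; toℕ-fromℕ<; toℕ<n; +↔⊎; 0≢1+n; suc-injective)
  renaming (_≟_ to _≟ᶠ_)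
open import Data.Fin.Subset using (Subset; inside; outside; _∈_; _⊆_; _∪_; ⁅_⁆)
open import Data.Fin.Subset.Properties
  using (_∈?_; x∈⁅x⁆; x∈⁅y⁆⇒x≡y; x∈p∪q⁻; x∈p∪q⁺; ⊆-antisym; ⊆-reflexive)
open import Data.Integer.Base as ℤ using (+_)
import Data.Integer.Properties as ℤ
open import Data.List.Base using (List; _∷_; lookup)
import Data.List.Membership.Propositional as List
open import Data.List.Membership.Propositional.Properties
  using (∈-lookup; ∈-map⁺; ∈-map⁻; ∈-++⁺ˡ; ∈-++⁺ʳ; ∈-filter⁺; ∈-filter⁻)
import Data.List.Relation.Unary.All as All
open import Data.List.Relation.Unary.AllPairs using ([]; _∷_)
open import Data.List.Relation.Unary.Any using (here; index)
open import Data.List.Relation.Unary.Any.Properties using (lookup-index)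
open import Data.List.Relation.Unary.Unique.Propositional using (Unique)
import Data.List.Relation.Unary.Unique.Propositional.Properties as Unique
open import Data.Nat.Base as ℕ using (ℕ; zero; suc; _%_) renaming (_≤_ to _≤ℕ_; _*_ to _*ℕ_)
import Data.Nat.DivMod as ℕ
open import Data.Nat.GeneralisedArithmetic using (iterate)
import Data.Nat.Properties as ℕ
open import Data.Nat.Properties using (<⇒≤)
open import Data.Product.Base using (Σ-syntax; ∃-syntax; _×_; _,_; proj₁; proj₂)
open import Data.Rational.Base as ℚ using (ℚ; mkℚ; 0ℚ; 1ℚ; ½; ∣_∣)
import Data.Rational.Properties as ℚ
open import Data.Rational.Solver using (module +-*-Solver)
import Data.Rational.Unnormalised.Base as ℚᵘ
import Data.Rational.Unnormalised.Properties as ℚᵘ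
open import Data.Sum.Base using (_⊎_; inj₁; inj₂; [_,_]′)
open import Data.Sum.Properties using (inj₁-injective; inj₂-injective)
open import Data.Vec.Base as Vec using (Vec; []; _∷_)
open import Data.Vec.Functional using (Vector)
open import Data.Vec.Properties using (∷-injectiveʳ)
open import Function.Base using (_∘_; id)
open import Function.Bundles using (_↔_; mk↔ₛ′; _⇔_; mk⇔)
open import Function.Construct.Composition using (_↔-∘_)
open import Relation.Binary.PropositionalEquality
  using (_≡_; _≢_; refl; sym; trans; cong; cong₂; subst; subst₂; module ≡-Reasoning)
open import Relation.Nullary using (¬_; yes; no; does; contradiction)
open import Relation.Unary as Unary using (Pred)

open CommutativeMonoidSum ℚ.+-0-commutativeMonoid
  using (sum-cong-≗; ∑-distrib-+; sum-replicate-zero) renaming (sum to ∑)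
open SemiringSum (CommutativeRing.semiring ℚ.+-*-commutativeRing) using (*-distribˡ-sum)

-- The induction over refinements carries a permutation `next` with local conditions, not an
-- isomorphism with a standard cycle: the vertices of a refinement come in the order of a filtered
-- list of subsets, and this order never has to be computed. The condition `next³≢` excludes
-- triangles. In a triangle the whole vertex set is a clique, and in the refinement that clique has
-- degree 6, so the refinement is no longer a cycle.
--
-- The ellipses come from u = w + w⁻¹, under which u ↦ u² - 2 becomes w ↦ w². The circle of radius ρ
-- in the w-plane goes to the ellipse with squared semi-axes (ρ + ρ⁻¹)² and (ρ - ρ⁻¹)². Taking e =
-- (ρ - ρ⁻¹)² as the parameter makes these e + 4 and e, so the whole escape argument is polynomial
-- over the rationals, with neither square roots nor w.

-- A disjoint union of cycles of length at least 4; connectedness plays no role.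
record Cyclic (G : Graph) : Set where
  field
    next prev : Fin (size G) → Fin (size G)
    next-prev : ∀ i → next (prev i) ≡ i
    prev-next : ∀ i → prev (next i) ≡ i
    adj⁻      : ∀ {i j} → Adj G i j → next i ≡ j ⊎ prev i ≡ j
    next-adj  : ∀ i → Adj G i (next i)
    next²≢    : ∀ i → next (next i) ≢ i
    next³≢    : ∀ i → next (next (next i)) ≢ i

  next≢ : ∀ i → next i ≢ i
  next≢ i eq = irrefl G (sym eq) (next-adj i)

  prev-adj : ∀ i → Adj G i (prev i)
  prev-adj i = symm G (subst (Adj G (prev i)) (next-prev i) (next-adj (prev i)))

  next≢prev : ∀ i → next i ≢ prev i
  next≢prev i eq = next²≢ i (trans (cong next eq) (next-prev i))

  next-injective : ∀ {i j} → next i ≡ next j → i ≡ j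
  next-injective {i} {j} eq = trans (sym (prev-next i)) (trans (cong prev eq) (prev-next j))

-- Standard cycles: rotations modulo n.

module _ (n : ℕ) (n≥4 : 4 ℕ.≤ n) where
  private
    instance
      n≢0 : ℕ.NonZero n
      n≢0 = ℕ.>-nonZero (ℕ.≤-trans (ℕ.s≤s ℕ.z≤n) n≥4)

    rotate : ℕ → Fin n → Fin n
    rotate k i = fromℕ< (ℕ.m%n<n (k ℕ.+ toℕ i) n)

    toℕ-rotate : ∀ k i → toℕ (rotate k i) ≡ (k ℕ.+ toℕ i) % n
    toℕ-rotate k i = toℕ-fromℕ< (ℕ.m%n<n (k ℕ.+ toℕ i) n)

    rotate-+ : ∀ j k i → rotate j (rotate k i) ≡ rotate (j ℕ.+ k) i
    rotate-+ j k i = toℕ-injective (begin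
      toℕ (rotate j (rotate k i))               ≡⟨ toℕ-rotate j (rotate k i) ⟩
      (j ℕ.+ toℕ (rotate k i)) % n              ≡⟨ cong (λ m → (j ℕ.+ m) % n) (toℕ-rotate k i) ⟩
      (j ℕ.+ (k ℕ.+ toℕ i) % n) % n             ≡⟨ ℕ.%-distribˡ-+ j ((k ℕ.+ toℕ i) % n) n ⟩
      (j % n ℕ.+ (k ℕ.+ toℕ i) % n % n) % n     ≡⟨ cong (λ m → (j % n ℕ.+ m) % n) (ℕ.m%n%n≡m%n (k ℕ.+ toℕ i) n) ⟩
      (j % n ℕ.+ (k ℕ.+ toℕ i) % n) % n         ≡⟨ ℕ.%-distribˡ-+ j (k ℕ.+ toℕ i) n ⟨
      (j ℕ.+ (k ℕ.+ toℕ i)) % n                 ≡⟨ cong (_% n) (ℕ.+-assoc j k (toℕ i)) ⟨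
      (j ℕ.+ k ℕ.+ toℕ i) % n                   ≡⟨ toℕ-rotate (j ℕ.+ k) i ⟨
      toℕ (rotate (j ℕ.+ k) i)                  ∎)
      where open ≡-Reasoning

    rotate-n : ∀ i → rotate n i ≡ i
    rotate-n i = toℕ-injective (begin
      toℕ (rotate n i)    ≡⟨ toℕ-rotate n i ⟩
      (n ℕ.+ toℕ i) % n   ≡⟨ cong (_% n) (ℕ.+-comm n (toℕ i)) ⟩
      (toℕ i ℕ.+ n) % n   ≡⟨ ℕ.[m+n]%n≡m%n (toℕ i) n ⟩
      toℕ i % n           ≡⟨ ℕ.m<n⇒m%n≡m (toℕ<n i) ⟩
      toℕ i               ∎)
      where open ≡-Reasoning

    -- If reduction modulo `n` changes nothing, the sum exceeds `toℕ i`. Otherwise the sum is below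
    -- 2n, reduction subtracts `n` exactly once, and a fixed point would force `suc k ≡ n`.
    rotate≢ : ∀ k i → suc k ℕ.< n → rotate (suc k) i ≢ i
    rotate≢ k i k<n eq with suc k ℕ.+ toℕ i ℕ.<? n
    ... | yes small = ℕ.m≢1+n+m (toℕ i) (sym (begin
      suc k ℕ.+ toℕ i          ≡⟨ ℕ.m<n⇒m%n≡m small ⟨
      (suc k ℕ.+ toℕ i) % n    ≡⟨ toℕ-rotate (suc k) i ⟨
      toℕ (rotate (suc k) i)   ≡⟨ cong toℕ eq ⟩
      toℕ i                    ∎))
      where open ≡-Reasoning
    ... | no large = ℕ.<⇒≢ k<n (ℕ.+-cancelʳ-≡ (toℕ i) (suc k) n (begin
      suc k ℕ.+ toℕ i                    ≡⟨ ℕ.m∸n+n≡m n≤ ⟨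
      (suc k ℕ.+ toℕ i) ℕ.∸ n ℕ.+ n      ≡⟨ cong (ℕ._+ n) wrapped ⟩
      toℕ i ℕ.+ n                        ≡⟨ ℕ.+-comm (toℕ i) n ⟩
      n ℕ.+ toℕ i                        ∎))
      where
      open ≡-Reasoning
      n≤ : n ℕ.≤ suc k ℕ.+ toℕ i
      n≤ = ℕ.≮⇒≥ large
      below : (suc k ℕ.+ toℕ i) ℕ.∸ n ℕ.< n
      below = ℕ.+-cancelʳ-< n _ _ (subst (ℕ._< n ℕ.+ n) (sym (ℕ.m∸n+n≡m n≤))
        (ℕ.+-mono-< k<n (toℕ<n i)))
      wrapped : (suc k ℕ.+ toℕ i) ℕ.∸ n ≡ toℕ i
      wrapped = begin
        (suc k ℕ.+ toℕ i) ℕ.∸ n        ≡⟨ ℕ.m<n⇒m%n≡m below ⟨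
        ((suc k ℕ.+ toℕ i) ℕ.∸ n) % n  ≡⟨ ℕ.m≤n⇒[n∸m]%m≡n%m n≤ ⟩
        (suc k ℕ.+ toℕ i) % n          ≡⟨ toℕ-rotate (suc k) i ⟨
        toℕ (rotate (suc k) i)         ≡⟨ cong toℕ eq ⟩
        toℕ i                          ∎

    1+[n-1] : suc (ℕ.pred n) ≡ n
    1+[n-1] = ℕ.suc-pred n

    inverseˡ : ∀ i → rotate 1 (rotate (ℕ.pred n) i) ≡ i
    inverseˡ i = trans (rotate-+ 1 (ℕ.pred n) i)
      (trans (cong (λ k → rotate k i) 1+[n-1]) (rotate-n i))

    inverseʳ : ∀ i → rotate (ℕ.pred n) (rotate 1 i) ≡ i
    inverseʳ i = trans (rotate-+ (ℕ.pred n) 1 i)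
      (trans (cong (λ k → rotate k i) (trans (ℕ.+-comm (ℕ.pred n) 1) 1+[n-1])) (rotate-n i))

    adjacent⁻ : ∀ {i j} → Adj (cycle n (ℕ.<⇒≤ n≥4)) i j →
      rotate 1 i ≡ j ⊎ rotate (ℕ.pred n) i ≡ j
    adjacent⁻ {i}     (inj₁ e) = inj₁ (toℕ-injective (trans (toℕ-rotate 1 i) e))
    adjacent⁻ {i} {j} (inj₂ e) = inj₂ (trans
      (cong (rotate (ℕ.pred n)) (sym (toℕ-injective (trans (toℕ-rotate 1 j) e))))
      (inverseʳ j))

  cycle-cyclic : Cyclic (cycle n (ℕ.<⇒≤ n≥4))
  cycle-cyclic = record
    { next      = rotate 1
    ; prev      = rotate (ℕ.pred n)
    ; next-prev = inverseˡ
    ; prev-next = inverseʳ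
    ; adj⁻      = adjacent⁻
    ; next-adj  = λ i → inj₁ (sym (toℕ-rotate 1 i))
    ; next²≢    = λ i eq → rotate≢ 1 i (ℕ.<-≤-trans (ℕ.s≤s (ℕ.s≤s (ℕ.s≤s ℕ.z≤n))) n≥4)
        (trans (sym (rotate-+ 1 1 i)) eq)
    ; next³≢    = λ i eq → rotate≢ 2 i n≥4
        (trans (sym (trans (cong (rotate 1) (rotate-+ 1 1 i)) (rotate-+ 1 2 i))) eq)
    }

-- Enumeration of subsets without repetition.

lookup-injective : ∀ {a} {A : Set a} {xs : List A} → Unique xs →
  ∀ {i j} → lookup xs i ≡ lookup xs j → i ≡ j
lookup-injective (_  ∷ _)  {zero}  {zero}  _  = refl
lookup-injective (px ∷ _)  {zero}  {suc j} eq = contradiction eq (All.lookup px (∈-lookup j))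
lookup-injective (px ∷ _)  {suc i} {zero}  eq = contradiction (sym eq) (All.lookup px (∈-lookup i))
lookup-injective (_  ∷ us) {suc i} {suc j} eq = cong suc (lookup-injective us eq)

∈-subsets : ∀ {n} (s : Subset n) → s List.∈ subsets n
∈-subsets []            = here refl
∈-subsets (inside  ∷ s) = ∈-++⁺ˡ (∈-map⁺ (inside ∷_) (∈-subsets s))
∈-subsets (outside ∷ s) = ∈-++⁺ʳ _ (∈-map⁺ (outside ∷_) (∈-subsets s))

-- Makes a position in `cliques` determined by the subset found there; a repeated subset would break
-- the count of vertices and the injectivity of `simplex`.
subsets-unique : ∀ n → Unique (subsets n)
subsets-unique zero    = All.[] ∷ []
subsets-unique (suc n) = Unique.++⁺
  (Unique.map⁺ ∷-injectiveʳ (subsets-unique n))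
  (Unique.map⁺ ∷-injectiveʳ (subsets-unique n))
  λ (s∈in , s∈out) → inside≢outside
    (trans (sym (proj₂ (proj₂ (∈-map⁻ _ s∈in)))) (proj₂ (proj₂ (∈-map⁻ _ s∈out))))
  where
  inside≢outside : ∀ {s t : Subset n} → inside ∷ s ≢ outside ∷ t
  inside≢outside ()

-- The refinement of a cyclic graph as its doubling.

-- The interface between combinatorics and linear algebra: `even` stands for the old vertices, `odd`
-- for the midpoints of edges. The spectral part relies on these laws alone and never sees a subset;
-- `halves` supplies the count of vertices.
record Doubling {G H : Graph} (C : Cyclic G) (D : Cyclic H) : Set where
  private
    module C = Cyclic C
    module D = Cyclic D
  field
    halves    : (Fin (size G) ⊎ Fin (size G)) ↔ Fin (size H)
    even odd  : Fin (size G) → Fin (size H)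
    split     : ∀ x → (∃[ i ] even i ≡ x) ⊎ (∃[ i ] odd i ≡ x)
    even-injective : ∀ {i j} → even i ≡ even j → i ≡ j
    odd≢even  : ∀ {i j} → odd i ≢ even j
    next-even : ∀ i → D.next (even i) ≡ odd i
    next-odd  : ∀ i → D.next (odd i) ≡ even (C.next i)

  prev-odd : ∀ i → D.prev (odd i) ≡ even i
  prev-odd i = trans (cong D.prev (sym (next-even i))) (D.prev-next (even i))

  prev-even : ∀ i → D.prev (even i) ≡ odd (C.prev i)
  prev-even i = begin
    D.prev (even i)                       ≡⟨ cong (D.prev ∘ even) (C.next-prev i) ⟨
    D.prev (even (C.next (C.prev i)))     ≡⟨ cong D.prev (next-odd (C.prev i)) ⟨
    D.prev (D.next (odd (C.prev i)))      ≡⟨ D.prev-next _ ⟩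
    odd (C.prev i)                        ∎
    where open ≡-Reasoning

  size-doubles : 2 ℕ.* size G ≡ size H
  size-doubles = trans (cong (size G ℕ.+_) (ℕ.+-identityʳ (size G)))
    (↔⇒≡ (halves ↔-∘ +↔⊎))

module Refinement {G : Graph} (C : Cyclic G) where
  open Cyclic C
  private
    V = Fin (size G)
    H = refinement G

  -- Orienting each edge along `next` indexes it by its source, so there are as many edges as
  -- vertices. This is the origin of the factor 2.
  cell : V ⊎ V → Subset (size G)
  cell (inj₁ i) = ⁅ i ⁆
  cell (inj₂ i) = ⁅ i ⁆ ∪ ⁅ next i ⁆

  ∈-edge⁻ : ∀ {x} i → x ∈ cell (inj₂ i) → x ≡ i ⊎ x ≡ next i
  ∈-edge⁻ i x∈ = [ inj₁ ∘ x∈⁅y⁆⇒x≡y _ , inj₂ ∘ x∈⁅y⁆⇒x≡y _ ]′ (x∈p∪q⁻ ⁅ i ⁆ ⁅ next i ⁆ x∈)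

  source∈edge : ∀ i → i ∈ cell (inj₂ i)
  source∈edge i = x∈p∪q⁺ (inj₁ (x∈⁅x⁆ i))

  target∈edge : ∀ i → next i ∈ cell (inj₂ i)
  target∈edge i = x∈p∪q⁺ (inj₂ (x∈⁅x⁆ (next i)))

  singleton⊆ : ∀ {i} {s : Subset (size G)} → i ∈ s → ⁅ i ⁆ ⊆ s
  singleton⊆ {s = s} i∈s x∈ = subst (_∈ s) (sym (x∈⁅y⁆⇒x≡y _ x∈)) i∈s

  edge⊆ : ∀ {i} {s : Subset (size G)} → i ∈ s → next i ∈ s → cell (inj₂ i) ⊆ s
  edge⊆ {i} {s} i∈s ni∈s x∈ with ∈-edge⁻ i x∈
  ... | inj₁ refl = i∈s
  ... | inj₂ refl = ni∈s

  edge⊈vertex : ∀ {i j} → ¬ cell (inj₂ i) ⊆ cell (inj₁ j)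
  edge⊈vertex {i} {j} ⊆j = next≢ i
    (trans (x∈⁅y⁆⇒x≡y j (⊆j (target∈edge i))) (sym (x∈⁅y⁆⇒x≡y j (⊆j (source∈edge i)))))

  vertex⊆vertex : ∀ {i j} → cell (inj₁ i) ⊆ cell (inj₁ j) → i ≡ j
  vertex⊆vertex {i} {j} ⊆j = x∈⁅y⁆⇒x≡y j (⊆j (x∈⁅x⁆ i))

  -- The only alternative to equal sources is the same edge traversed backwards, which would close a
  -- cycle of length 2.
  edge⊆edge : ∀ {i j} → cell (inj₂ i) ⊆ cell (inj₂ j) → i ≡ j
  edge⊆edge {i} {j} ⊆j with ∈-edge⁻ j (⊆j (source∈edge i)) | ∈-edge⁻ j (⊆j (target∈edge i))
  ... | inj₁ i≡j  | _          = i≡j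
  ... | inj₂ i≡nj | inj₁ ni≡j  = contradiction (trans (cong next (sym i≡nj)) ni≡j) (next²≢ j)
  ... | inj₂ _    | inj₂ ni≡nj = next-injective ni≡nj

  cell-injective : ∀ {x y} → cell x ≡ cell y → x ≡ y
  cell-injective {inj₁ i} {inj₁ j} eq = cong inj₁ (vertex⊆vertex {i} {j} (⊆-reflexive eq))
  cell-injective {inj₁ i} {inj₂ j} eq = ⊥-elim (edge⊈vertex {j} {i} (⊆-reflexive (sym eq)))
  cell-injective {inj₂ i} {inj₁ j} eq = ⊥-elim (edge⊈vertex {i} {j} (⊆-reflexive eq))
  cell-injective {inj₂ i} {inj₂ j} eq = cong inj₂ (edge⊆edge {i} {j} (⊆-reflexive eq))

  cell-clique : ∀ x → Clique G (cell x)
  cell-clique (inj₁ i) = (i , x∈⁅x⁆ i) , λ x y x∈ y∈ x≢y →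
    contradiction (trans (x∈⁅y⁆⇒x≡y i x∈) (sym (x∈⁅y⁆⇒x≡y i y∈))) x≢y
  cell-clique (inj₂ i) = (i , source∈edge i) , λ x y x∈ y∈ x≢y →
    adjacent (∈-edge⁻ i x∈) (∈-edge⁻ i y∈) x≢y
    where
    adjacent : ∀ {x y} → x ≡ i ⊎ x ≡ next i → y ≡ i ⊎ y ≡ next i → x ≢ y → Adj G x y
    adjacent (inj₁ refl) (inj₁ refl) x≢y = contradiction refl x≢y
    adjacent (inj₁ refl) (inj₂ refl) _   = next-adj i
    adjacent (inj₂ refl) (inj₁ refl) _   = symm G (next-adj i)
    adjacent (inj₂ refl) (inj₂ refl) x≢y = contradiction refl x≢y

  -- A third vertex of the clique is a neighbour of both `i` and `next i`, hence equals `prev i` and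
  -- `next (next i)` at once; that is a triangle, excluded by `next³≢`.
  edge-clique : ∀ {i} {s : Subset (size G)} → Clique G s → i ∈ s → next i ∈ s → cell (inj₂ i) ≡ s
  edge-clique {i} {s} (_ , complete) i∈s ni∈s = ⊆-antisym (edge⊆ i∈s ni∈s) s⊆edge
    where
    s⊆edge : s ⊆ cell (inj₂ i)
    s⊆edge {z} z∈s with i ≟ᶠ z | next i ≟ᶠ z
    ... | yes refl | _        = source∈edge i
    ... | no _     | yes refl = target∈edge i
    ... | no i≢z   | no ni≢z
      with adj⁻ (complete i z i∈s z∈s i≢z) | adj⁻ (complete (next i) z ni∈s z∈s ni≢z)
    ... | inj₁ ni≡z | _          = contradiction ni≡z ni≢z
    ... | inj₂ pi≡z | inj₁ nni≡z = contradiction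
      (trans (cong next (trans nni≡z (sym pi≡z))) (next-prev i)) (next³≢ i)
    ... | inj₂ _    | inj₂ pni≡z = contradiction (trans (sym (prev-next i)) pni≡z) i≢z

  -- A witness `i` of non-emptiness has only the neighbours `next i` and `prev i`. If one of them
  -- lies in the clique, that edge is all of it; otherwise nothing can be added to `i`.
  clique-cell : ∀ {s : Subset (size G)} → Clique G s → ∃[ x ] cell x ≡ s
  clique-cell {s} c@((i , i∈s) , complete) with next i ∈? s | prev i ∈? s
  ... | yes ni∈s | _        = inj₂ i , edge-clique c i∈s ni∈s
  ... | no _     | yes pi∈s = inj₂ (prev i) ,
    edge-clique c pi∈s (subst (_∈ s) (sym (next-prev i)) i∈s)
  ... | no ni∉s  | no pi∉s  = inj₁ i , ⊆-antisym (singleton⊆ i∈s) s⊆vertex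
    where
    s⊆vertex : s ⊆ cell (inj₁ i)
    s⊆vertex {z} z∈s with i ≟ᶠ z
    ... | yes refl = x∈⁅x⁆ i
    ... | no i≢z with adj⁻ (complete i z i∈s z∈s i≢z)
    ...   | inj₁ refl = contradiction z∈s ni∉s
    ...   | inj₂ refl = contradiction z∈s pi∉s

  simplex : Fin (size H) → Subset (size G)
  simplex = lookup (cliques G)

  simplex-injective : ∀ {k l} → simplex k ≡ simplex l → k ≡ l
  simplex-injective = lookup-injective (Unique.filter⁺ (clique? G) (subsets-unique (size G)))

  simplex-clique : ∀ k → Clique G (simplex k)
  simplex-clique k = proj₂ (∈-filter⁻ (clique? G) {xs = subsets (size G)} (∈-lookup k))

  cell∈cliques : ∀ x → cell x List.∈ cliques G
  cell∈cliques x = ∈-filter⁺ (clique? G) (∈-subsets (cell x)) (cell-clique x)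

  -- The position is extracted from a membership proof, and `decode` from the classification of
  -- cliques, so that the two are inverse whatever the order of the list.
  code : V ⊎ V → Fin (size H)
  code x = index (cell∈cliques x)

  simplex-code : ∀ x → simplex (code x) ≡ cell x
  simplex-code x = sym (lookup-index (cell∈cliques x))

  decode : Fin (size H) → V ⊎ V
  decode k = proj₁ (clique-cell (simplex-clique k))

  cell-decode : ∀ k → cell (decode k) ≡ simplex k
  cell-decode k = proj₂ (clique-cell (simplex-clique k))

  code-decode : ∀ k → code (decode k) ≡ k
  code-decode k = simplex-injective (trans (simplex-code (decode k)) (cell-decode k))

  decode-code : ∀ x → decode (code x) ≡ x
  decode-code x = cell-injective (trans (cell-decode (code x)) (simplex-code x))

  code-injective : ∀ {x y} → code x ≡ code y → x ≡ y
  code-injective {x} {y} eq = trans (sym (decode-code x)) (trans (cong decode eq) (decode-code y))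

  step back : V ⊎ V → V ⊎ V
  step (inj₁ i) = inj₂ i
  step (inj₂ i) = inj₁ (next i)
  back (inj₁ i) = inj₂ (prev i)
  back (inj₂ i) = inj₁ i

  step-back : ∀ x → step (back x) ≡ x
  step-back (inj₁ i) = cong inj₁ (next-prev i)
  step-back (inj₂ i) = refl

  back-step : ∀ x → back (step x) ≡ x
  back-step (inj₁ i) = refl
  back-step (inj₂ i) = cong inj₂ (prev-next i)

  -- Two steps in the refinement amount to one step of `next`, so this is `next≢`; three steps turn
  -- a vertex into an edge or conversely. Length at least 4 therefore survives refinement.
  step²≢ : ∀ x → step (step x) ≢ x
  step²≢ (inj₁ i) eq = next≢ i (inj₁-injective eq)
  step²≢ (inj₂ i) eq = next≢ i (inj₂-injective eq)

  step³≢ : ∀ x → step (step (step x)) ≢ x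
  step³≢ (inj₁ i) ()
  step³≢ (inj₂ i) ()

  nested⇒step : ∀ x y → x ≢ y → cell x ⊆ cell y → step x ≡ y ⊎ back x ≡ y
  nested⇒step (inj₁ i) (inj₁ j) x≢y x⊆y = contradiction (cong inj₁ (vertex⊆vertex {i} {j} x⊆y)) x≢y
  nested⇒step (inj₂ i) (inj₁ j) x≢y x⊆y = ⊥-elim (edge⊈vertex {i} {j} x⊆y)
  nested⇒step (inj₂ i) (inj₂ j) x≢y x⊆y = contradiction (cong inj₂ (edge⊆edge {i} {j} x⊆y)) x≢y
  nested⇒step (inj₁ i) (inj₂ j) x≢y x⊆y with ∈-edge⁻ j (x⊆y (x∈⁅x⁆ i))
  ... | inj₁ refl = inj₁ refl
  ... | inj₂ refl = inj₂ (cong inj₂ (prev-next j))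

  comparable⇒step : ∀ x y → x ≢ y → cell x ⊆ cell y ⊎ cell y ⊆ cell x → step x ≡ y ⊎ back x ≡ y
  comparable⇒step x y x≢y (inj₁ x⊆y) = nested⇒step x y x≢y x⊆y
  comparable⇒step x y x≢y (inj₂ y⊆x) with nested⇒step y x (x≢y ∘ sym) y⊆x
  ... | inj₁ refl = inj₂ (back-step y)
  ... | inj₂ refl = inj₁ (step-back y)

  step⇒comparable : ∀ x → cell x ⊆ cell (step x) ⊎ cell (step x) ⊆ cell x
  step⇒comparable (inj₁ i) = inj₁ (singleton⊆ (source∈edge i))
  step⇒comparable (inj₂ i) = inj₂ (singleton⊆ (target∈edge i))

  step≢ : ∀ x → x ≢ step x
  step≢ (inj₁ i) ()
  step≢ (inj₂ i) ()

  refinement-cyclic : Cyclic H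
  refinement-cyclic = record
    { next      = code ∘ step ∘ decode
    ; prev      = code ∘ back ∘ decode
    ; next-prev = λ k → trans (cong (code ∘ step) (decode-code (back (decode k))))
        (trans (cong code (step-back (decode k))) (code-decode k))
    ; prev-next = λ k → trans (cong (code ∘ back) (decode-code (step (decode k))))
        (trans (cong code (back-step (decode k))) (code-decode k))
    ; adj⁻      = adjacent⁻
    ; next-adj  = adjacent⁺
    ; next²≢    = λ k eq → step²≢ (decode k) (trans (decode-next² k) (cong decode eq))
    ; next³≢    = λ k eq → step³≢ (decode k) (trans (decode-next³ k) (cong decode eq))
    }
    where
    succ : Fin (size H) → Fin (size H)
    succ k = code (step (decode k))

    decode-next : ∀ k → step (decode k) ≡ decode (succ k)
    decode-next k = sym (decode-code (step (decode k)))

    decode-next² : ∀ k → step (step (decode k)) ≡ decode (succ (succ k))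
    decode-next² k = trans (cong step (decode-next k)) (decode-next (succ k))

    decode-next³ : ∀ k → step (step (step (decode k))) ≡ decode (succ (succ (succ k)))
    decode-next³ k = trans (cong step (decode-next² k)) (decode-next (succ (succ k)))

    adjacent⁻ : ∀ {k l} → Adj H k l → code (step (decode k)) ≡ l ⊎ code (back (decode k)) ≡ l
    adjacent⁻ {k} {l} (k≢l , nested)
      with comparable⇒step (decode k) (decode l)
             (λ eq → k≢l (trans (sym (cell-decode k)) (trans (cong cell eq) (cell-decode l))))
             (subst (λ s → s ⊆ cell (decode l) ⊎ cell (decode l) ⊆ s) (sym (cell-decode k))
               (subst (λ s → simplex k ⊆ s ⊎ s ⊆ simplex k) (sym (cell-decode l)) nested))
    ... | inj₁ eq = inj₁ (trans (cong code eq) (code-decode l))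
    ... | inj₂ eq = inj₂ (trans (cong code eq) (code-decode l))

    adjacent⁺ : ∀ k → Adj H k (code (step (decode k)))
    adjacent⁺ k =
      (λ eq → step≢ (decode k)
        (cell-injective (trans (cell-decode k) (trans eq (simplex-code _))))) ,
      subst (λ s → s ⊆ simplex (code y) ⊎ simplex (code y) ⊆ s) (cell-decode k)
        (subst (λ s → cell x ⊆ s ⊎ s ⊆ cell x) (sym (simplex-code y)) (step⇒comparable x))
      where
      x = decode k
      y = step x

  doubling : Doubling C refinement-cyclic
  doubling = record
    { halves    = mk↔ₛ′ code decode code-decode decode-code
    ; even      = code ∘ inj₁
    ; odd       = code ∘ inj₂
    ; split     = split
    ; even-injective = λ eq → inj₁-injective (code-injective eq)
    ; odd≢even  = λ {i} {j} eq → contradiction (code-injective {inj₂ i} {inj₁ j} eq) λ ()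
    ; next-even = λ i → cong (code ∘ step) (decode-code (inj₁ i))
    ; next-odd  = λ i → cong (code ∘ step) (decode-code (inj₂ i))
    }
    where
    split : ∀ k → (∃[ i ] code (inj₁ i) ≡ k) ⊎ (∃[ i ] code (inj₂ i) ≡ k)
    split k with decode k in eq
    ... | inj₁ i = inj₁ (i , trans (cong code (sym eq)) (code-decode k))
    ... | inj₂ i = inj₂ (i , trans (cong code (sym eq)) (code-decode k))

open Refinement using (refinement-cyclic; doubling)

-- Reals through their rational terms

2ℚ 4ℚ 8ℚ : ℚ
2ℚ = + 2 ℚ./ 1
4ℚ = + 4 ℚ./ 1
8ℚ = + 8 ℚ./ 1

-- The matrix entries are constant sequences and ring operations act index by index, so most
-- equalities of reals below reduce to identities in `ℚ`.
≡⇒≈ : ∀ {x y} → (∀ n → seq x n ≡ seq y n) → x ≈ y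
≡⇒≈ {x} {y} eq ε 0<ε = 0 , λ n _ → subst (ℚ._< ε)
  (sym (cong ∣_∣ (trans (cong (ℚ._- seq y n) (eq n)) (ℚ.+-inverseʳ (seq y n))))) 0<ε

≈-sym : ∀ {x y} → x ≈ y → y ≈ x
≈-sym {x} {y} x≈y ε 0<ε =
  let N , close = x≈y ε 0<ε
  in N , λ n N≤n → subst (ℚ._< ε)
       (trans (sym (ℚ.∣-p∣≡∣p∣ _)) (cong ∣_∣ (flip (seq x n) (seq y n)))) (close n N≤n)
  where
  flip : ∀ a b → ℚ.- (a ℚ.- b) ≡ b ℚ.- a
  flip = solve 2 (λ a b → :- (a :- b) := b :- a) refl
    where open +-*-Solver

half-positive : ∀ {ε} → 0ℚ ℚ.< ε → 0ℚ ℚ.< ½ ℚ.* ε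
half-positive {ε} 0<ε = ℚ.positive⁻¹ (½ ℚ.* ε) {{ℚ.pos*pos⇒pos ½ ε {{ℚ.positive 0<ε}}}}

½+½ : ∀ ε → ½ ℚ.* ε ℚ.+ ½ ℚ.* ε ≡ ε
½+½ ε = trans (sym (ℚ.*-distribʳ-+ ε ½ ½)) (ℚ.*-identityˡ ε)

∣+∣<½+½ : ∀ {p q ε} → ∣ p ∣ ℚ.< ½ ℚ.* ε → ∣ q ∣ ℚ.< ½ ℚ.* ε → ∣ p ℚ.+ q ∣ ℚ.< ε
∣+∣<½+½ {p} {q} {ε} p< q< = begin-strict
  ∣ p ℚ.+ q ∣            ≤⟨ ℚ.∣p+q∣≤∣p∣+∣q∣ p q ⟩
  ∣ p ∣ ℚ.+ ∣ q ∣        <⟨ ℚ.+-mono-< {∣ p ∣} {½ ℚ.* ε} {∣ q ∣} {½ ℚ.* ε} p< q< ⟩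
  ½ ℚ.* ε ℚ.+ ½ ℚ.* ε    ≡⟨ ½+½ ε ⟩
  ε                      ∎
  where open ℚ.≤-Reasoning

-- One ε/2 argument for transitivity and for sums alike: the error in the conclusion is, term by
-- term, the sum of the two given errors.
≈-combine : ∀ {a b c d e f} →
  (∀ n → (seq a n ℚ.- seq b n) ℚ.+ (seq c n ℚ.- seq d n) ≡ seq e n ℚ.- seq f n) →
  a ≈ b → c ≈ d → e ≈ f
≈-combine {a} {b} {c} {d} {e} {f} rearrange a≈b c≈d ε 0<ε =
  let M , a-b = a≈b (½ ℚ.* ε) (half-positive 0<ε)
      N , c-d = c≈d (½ ℚ.* ε) (half-positive 0<ε)
  in M ℕ.⊔ N , λ n ≤n → subst (ℚ._< ε) (cong ∣_∣ (rearrange n))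
       (∣+∣<½+½ {seq a n ℚ.- seq b n} {seq c n ℚ.- seq d n}
         (a-b n (ℕ.m⊔n≤o⇒m≤o M N ≤n)) (c-d n (ℕ.m⊔n≤o⇒n≤o M N ≤n)))

telescope : ∀ a b c → (a ℚ.- b) ℚ.+ (b ℚ.- c) ≡ a ℚ.- c
telescope = solve 3 (λ a b c → (a :- b) :+ (b :- c) := a :- c) refl
  where open +-*-Solver

≈-trans : ∀ {x y z} → x ≈ y → y ≈ z → x ≈ z
≈-trans {x} {y} {z} = ≈-combine {x} {y} {y} {z} {x} {z}
  (λ n → telescope (seq x n) (seq y n) (seq z n))

0+0≈0 : ∀ {x y} → x ≈ fromℕ 0 → y ≈ fromℕ 0 → x + y ≈ fromℕ 0
0+0≈0 {x} {y} = ≈-combine {x} {fromℕ 0} {y} {fromℕ 0} {x + y} {fromℕ 0}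
  (λ n → rearrange (seq x n) (seq y n))
  where
  rearrange : ∀ a b → (a ℚ.- 0ℚ) ℚ.+ (b ℚ.- 0ℚ) ≡ (a ℚ.+ b) ℚ.- 0ℚ
  rearrange = solve 2 (λ a b → (a :- con 0ℚ) :+ (b :- con 0ℚ) := (a :+ b) :- con 0ℚ) refl
    where open +-*-Solver

-- The terms of `c` are eventually bounded by some `B`, so it is enough to bring `x` within ε/B of
-- zero.
*0≈0 : ∀ c {x} → x ≈ fromℕ 0 → c * x ≈ fromℕ 0
*0≈0 c {x} x≈0 ε 0<ε =
  let B , 0<B , M , c≤B = eventuallyBounded c
      instance
        B-pos : ℚ.Positive B
        B-pos = ℚ.positive 0<B
        B≢0 : ℚ.NonZero B
        B≢0 = ℚ.pos⇒nonZero B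
        1/B-pos : ℚ.Positive (ℚ.1/ B)
        1/B-pos = ℚ.1/pos⇒pos B
        ε-pos : ℚ.Positive ε
        ε-pos = ℚ.positive 0<ε
      N , x-small = x≈0 (ℚ.1/ B ℚ.* ε) (ℚ.positive⁻¹ (ℚ.1/ B ℚ.* ε) {{ℚ.pos*pos⇒pos (ℚ.1/ B) ε}})
  in M ℕ.⊔ N , λ n ≤n → small B {seq c n} {seq x n}
       (c≤B n (ℕ.m⊔n≤o⇒m≤o M N ≤n)) (x-small n (ℕ.m⊔n≤o⇒n≤o M N ≤n))
  where
  open ℚ.≤-Reasoning
  small : ∀ B .{{_ : ℚ.Positive B}} .{{_ : ℚ.NonZero B}} {p q} →
    ∣ p ∣ ℚ.≤ B → ∣ q ℚ.- 0ℚ ∣ ℚ.< ℚ.1/ B ℚ.* ε → ∣ p ℚ.* q ℚ.- 0ℚ ∣ ℚ.< ε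
  small B {p} {q} p≤B q< = begin-strict
    ∣ p ℚ.* q ℚ.- 0ℚ ∣        ≡⟨ cong ∣_∣ (ℚ.+-identityʳ (p ℚ.* q)) ⟩
    ∣ p ℚ.* q ∣               ≡⟨ ℚ.∣p*q∣≡∣p∣*∣q∣ p q ⟩
    ∣ p ∣ ℚ.* ∣ q ∣           ≤⟨ ℚ.*-monoʳ-≤-nonNeg ∣ q ∣ {{ℚ.∣-∣-nonNeg q}} p≤B ⟩
    B ℚ.* ∣ q ∣               ≡⟨ cong (λ r → B ℚ.* ∣ r ∣) (ℚ.+-identityʳ q) ⟨
    B ℚ.* ∣ q ℚ.- 0ℚ ∣        <⟨ ℚ.*-monoʳ-<-pos B q< ⟩
    B ℚ.* (ℚ.1/ B ℚ.* ε)      ≡⟨ ℚ.*-assoc B (ℚ.1/ B) ε ⟨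
    B ℚ.* ℚ.1/ B ℚ.* ε        ≡⟨ cong (ℚ._* ε) (ℚ.*-inverseʳ B) ⟩
    1ℚ ℚ.* ε                  ≡⟨ ℚ.*-identityˡ ε ⟩
    ε                         ∎

sum≈0 : ∀ {n} {v : Vector ℝ n} → (∀ i → v i ≈ fromℕ 0) → sum v ≈ fromℕ 0
sum≈0 {zero}      v≈0 = ≡⇒≈ {fromℕ 0} {fromℕ 0} (λ _ → refl)
sum≈0 {suc n} {v} v≈0 = 0+0≈0 {v zero} {sum (v ∘ suc)} (v≈0 zero) (sum≈0 (v≈0 ∘ suc))

seq-sum : ∀ {d} (v : Vector ℝ d) n → seq (sum v) n ≡ ∑ (λ i → seq (v i) n)
seq-sum {zero}  v n = refl
seq-sum {suc d} v n = cong (seq (v zero) n ℚ.+_) (seq-sum (v ∘ suc) n)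

-- Kronecker delta, finite sums and counting.

δ : ∀ {n} → Fin n → Fin n → ℚ
δ i j = if does (i ≟ᶠ j) then 1ℚ else 0ℚ

δ-≡ : ∀ {n} {i j : Fin n} → i ≡ j → δ i j ≡ 1ℚ
δ-≡ {i = i} {j} i≡j with i ≟ᶠ j
... | yes _  = refl
... | no i≢j = contradiction i≡j i≢j

δ-≢ : ∀ {n} {i j : Fin n} → i ≢ j → δ i j ≡ 0ℚ
δ-≢ {i = i} {j} i≢j with i ≟ᶠ j
... | yes i≡j = contradiction i≡j i≢j
... | no _    = refl

∑-δ : ∀ {n} (i : Fin n) (f : Vector ℚ n) → ∑ (λ j → δ i j ℚ.* f j) ≡ f i
∑-δ {suc n} zero f = begin
  1ℚ ℚ.* f zero ℚ.+ ∑ (λ j → 0ℚ ℚ.* f (suc j))  ≡⟨ cong₂ ℚ._+_ (ℚ.*-identityˡ (f zero))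
                                                     (trans (sum-cong-≗ (λ j → ℚ.*-zeroˡ (f (suc j)))) (sum-replicate-zero n)) ⟩
  f zero ℚ.+ 0ℚ                                 ≡⟨ ℚ.+-identityʳ (f zero) ⟩
  f zero                                        ∎
  where open ≡-Reasoning
∑-δ {suc n} (suc i) f = begin
  0ℚ ℚ.* f zero ℚ.+ ∑ (λ j → δ i j ℚ.* f (suc j))  ≡⟨ cong₂ ℚ._+_ (ℚ.*-zeroˡ (f zero)) (∑-δ i (f ∘ suc)) ⟩
  0ℚ ℚ.+ f (suc i)                                 ≡⟨ ℚ.+-identityˡ (f (suc i)) ⟩
  f (suc i)                                        ∎
  where open ≡-Reasoning

∑-zero : ∀ {n} {f : Vector ℚ n} → (∀ i → f i ≡ 0ℚ) → ∑ f ≡ 0ℚ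
∑-zero {n} f≡0 = trans (sum-cong-≗ f≡0) (sum-replicate-zero n)

module _ {a} {A : Set a} where

  count-none : ∀ {p} {P : Pred A p} (P? : Unary.Decidable P) {n} (f : Fin n → A) →
    (∀ j → ¬ P (f j)) → Vec.count P? (Vec.tabulate f) ≡ 0
  count-none P? {zero}  f ¬P = refl
  count-none P? {suc n} f ¬P with P? (f zero)
  ... | yes p = contradiction p (¬P zero)
  ... | no _  = count-none P? (f ∘ suc) (¬P ∘ suc)

  count-one : ∀ {p} {P : Pred A p} (P? : Unary.Decidable P) {n} (f : Fin n → A) i →
    P (f i) → (∀ j → P (f j) → i ≡ j) → Vec.count P? (Vec.tabulate f) ≡ 1
  count-one P? {suc n} f zero Pi unique with P? (f zero)
  ... | yes _ = cong suc (count-none P? (f ∘ suc) (λ j Pj → 0≢1+n (unique (suc j) Pj)))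
  ... | no ¬p = contradiction Pi ¬p
  count-one P? {suc n} f (suc i) Pi unique with P? (f zero)
  ... | yes p = contradiction (sym (unique zero p)) (λ ())
  ... | no _  = count-one P? (f ∘ suc) i Pi (λ j Pj → suc-injective (unique (suc j) Pj))

  -- Serves to compute degrees: the neighbours of a vertex split into its successor and its
  -- predecessor, one of each.
  count-disjoint : ∀ {p q r} {P : Pred A p} {Q : Pred A q} {R : Pred A r}
    (P? : Unary.Decidable P) (Q? : Unary.Decidable Q) (R? : Unary.Decidable R) →
    (∀ {x} → P x → R x) → (∀ {x} → Q x → R x) → (∀ {x} → R x → P x ⊎ Q x) →
    (∀ {x} → P x → ¬ Q x) → ∀ {n} (xs : Vec A n) →
    Vec.count R? xs ≡ Vec.count P? xs ℕ.+ Vec.count Q? xs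
  count-disjoint P? Q? R? P⇒R Q⇒R R⇒P⊎Q disjoint = go
    where
    go : ∀ {n} (xs : Vec A n) → Vec.count R? xs ≡ Vec.count P? xs ℕ.+ Vec.count Q? xs
    go []       = refl
    go (x ∷ xs) with P? x | Q? x | R? x
    ... | yes p | yes q | _     = contradiction q (disjoint p)
    ... | yes p | no _  | yes _ = cong suc (go xs)
    ... | yes p | no _  | no ¬r = contradiction (P⇒R p) ¬r
    ... | no _  | yes q | yes _ = trans (cong suc (go xs)) (sym (ℕ.+-suc _ _))
    ... | no _  | yes q | no ¬r = contradiction (Q⇒R q) ¬r
    ... | no ¬p | no ¬q | yes r with R⇒P⊎Q r
    ...   | inj₁ p = contradiction p ¬p
    ...   | inj₂ q = contradiction q ¬q
    go (x ∷ xs) | no _ | no _ | no _ = go xs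

-- The Laplacian of a cyclic graph

module _ {G : Graph} (C : Cyclic G) where
  open Cyclic C

  cyclic-degree : ∀ i → degree G i ≡ 2
  cyclic-degree i = trans
    (count-disjoint (next i ≟ᶠ_) (prev i ≟ᶠ_) (adj? G i)
      (λ { refl → next-adj i }) (λ { refl → prev-adj i }) adj⁻
      (λ { refl pi≡ni → next≢prev i (sym pi≡ni) }) (Vec.allFin (size G)))
    (cong₂ ℕ._+_ (count-one (next i ≟ᶠ_) id (next i) refl (λ _ → id))
                 (count-one (prev i ≟ᶠ_) id (prev i) refl (λ _ → id)))

  laplacianℚ : Fin (size G) → Fin (size G) → ℚ
  laplacianℚ i j = 2ℚ ℚ.* δ i j ℚ.- (δ (next i) j ℚ.+ δ (prev i) j)

  seq-degree : ∀ i j n → seq (degreeMatrix G i j) n ≡ 2ℚ ℚ.* δ i j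
  seq-degree i j n with i ≟ᶠ j
  ... | yes _ = cong (λ d → + d ℚ./ 1) (cyclic-degree i)
  ... | no  _ = refl

  -- The sum never reaches 2 because `next i` and `prev i` are distinct.
  seq-adjacency : ∀ i j n → seq (adjacencyMatrix G i j) n ≡ δ (next i) j ℚ.+ δ (prev i) j
  seq-adjacency i j n with adj? G i j
  ... | no ¬adj = sym (cong₂ ℚ._+_
    (δ-≢ {i = next i} {j} (λ { refl → ¬adj (next-adj i) }))
    (δ-≢ {i = prev i} {j} (λ { refl → ¬adj (prev-adj i) })))
  ... | yes adj with adj⁻ adj
  ...   | inj₁ refl = sym (cong₂ ℚ._+_ (δ-≡ {i = next i} refl) (δ-≢ (next≢prev i ∘ sym)))
  ...   | inj₂ refl = sym (cong₂ ℚ._+_ (δ-≢ (next≢prev i)) (δ-≡ {i = prev i} refl))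

  seq-laplacian : ∀ i j n → seq (laplacian G i j) n ≡ laplacianℚ i j
  seq-laplacian i j n = cong₂ ℚ._-_ (seq-degree i j n) (seq-adjacency i j n)

  -- The Laplacian acts as a second difference. Applied with `f` a column of the Laplacian, this
  -- evaluates the entries of its square.
  ∑-laplacianℚ : ∀ i f → ∑ (λ k → laplacianℚ i k ℚ.* f k) ≡ 2ℚ ℚ.* f i ℚ.- (f (next i) ℚ.+ f (prev i))
  ∑-laplacianℚ i f = begin
    ∑ (λ k → laplacianℚ i k ℚ.* f k)
      ≡⟨ sum-cong-≗ (λ k → expand (δ i k) (δ (next i) k) (δ (prev i) k) (f k)) ⟩
    ∑ (λ k → 2ℚ ℚ.* (δ i k ℚ.* f k) ℚ.+ (ℚ.- 1ℚ ℚ.* (δ (next i) k ℚ.* f k) ℚ.+ ℚ.- 1ℚ ℚ.* (δ (prev i) k ℚ.* f k)))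
      ≡⟨ ∑-distrib-+ (λ k → 2ℚ ℚ.* (δ i k ℚ.* f k)) _ ⟩
    ∑ (λ k → 2ℚ ℚ.* (δ i k ℚ.* f k)) ℚ.+ ∑ (λ k → ℚ.- 1ℚ ℚ.* (δ (next i) k ℚ.* f k) ℚ.+ ℚ.- 1ℚ ℚ.* (δ (prev i) k ℚ.* f k))
      ≡⟨ cong₂ ℚ._+_ (scale 2ℚ i) (trans (∑-distrib-+ (λ k → ℚ.- 1ℚ ℚ.* (δ (next i) k ℚ.* f k)) _)
           (cong₂ ℚ._+_ (scale (ℚ.- 1ℚ) (next i)) (scale (ℚ.- 1ℚ) (prev i)))) ⟩
    2ℚ ℚ.* f i ℚ.+ (ℚ.- 1ℚ ℚ.* f (next i) ℚ.+ ℚ.- 1ℚ ℚ.* f (prev i))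
      ≡⟨ collect (f i) (f (next i)) (f (prev i)) ⟩
    2ℚ ℚ.* f i ℚ.- (f (next i) ℚ.+ f (prev i)) ∎
    where
    open ≡-Reasoning
    open +-*-Solver
    scale : ∀ c l → ∑ (λ k → c ℚ.* (δ l k ℚ.* f k)) ≡ c ℚ.* f l
    scale c l = trans (sym (*-distribˡ-sum c (λ k → δ l k ℚ.* f k))) (cong (c ℚ.*_) (∑-δ l f))
    expand : ∀ d d′ d″ x → (2ℚ ℚ.* d ℚ.- (d′ ℚ.+ d″)) ℚ.* x ≡
      2ℚ ℚ.* (d ℚ.* x) ℚ.+ (ℚ.- 1ℚ ℚ.* (d′ ℚ.* x) ℚ.+ ℚ.- 1ℚ ℚ.* (d″ ℚ.* x))
    expand = solve 4 (λ d d′ d″ x → (con 2ℚ :* d :- (d′ :+ d″)) :* x :=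
      con 2ℚ :* (d :* x) :+ (con (ℚ.- 1ℚ) :* (d′ :* x) :+ con (ℚ.- 1ℚ) :* (d″ :* x))) refl
    collect : ∀ x y z → 2ℚ ℚ.* x ℚ.+ (ℚ.- 1ℚ ℚ.* y ℚ.+ ℚ.- 1ℚ ℚ.* z) ≡ 2ℚ ℚ.* x ℚ.- (y ℚ.+ z)
    collect = solve 3 (λ x y z → con 2ℚ :* x :+ (con (ℚ.- 1ℚ) :* y :+ con (ℚ.- 1ℚ) :* z) := con 2ℚ :* x :- (y :+ z)) refl

  T-laplacian : Matrix (size G)
  T-laplacian = T (matrixRawRing (size G)) (laplacian G)

  -- With L = 2 − (s + s⁻¹) for the shift s, T(L) = 4 − (2 − L)² = 2 − (s² + s⁻²).
  seq-T-laplacian : ∀ i j n → seq (T-laplacian i j) n ≡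
    2ℚ ℚ.* δ i j ℚ.- (δ (next (next i)) j ℚ.+ δ (prev (prev i)) j)
  seq-T-laplacian i j n = begin
    seq (T-laplacian i j) n
      ≡⟨ cong₂ (λ l s → (l ℚ.+ (l ℚ.+ (l ℚ.+ (l ℚ.+ 0ℚ)))) ℚ.- s) (seq-laplacian i j n) square ⟩
    (ℓ i ℚ.+ (ℓ i ℚ.+ (ℓ i ℚ.+ (ℓ i ℚ.+ 0ℚ)))) ℚ.- (2ℚ ℚ.* ℓ i ℚ.- (ℓ (next i) ℚ.+ ℓ (prev i)))
      ≡⟨ cong₂ (λ y z → (ℓ i ℚ.+ (ℓ i ℚ.+ (ℓ i ℚ.+ (ℓ i ℚ.+ 0ℚ)))) ℚ.- (2ℚ ℚ.* ℓ i ℚ.- (y ℚ.+ z)))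
           (cong (λ k → 2ℚ ℚ.* δ (next i) j ℚ.- (δ (next (next i)) j ℚ.+ δ k j)) (prev-next i))
           (cong (λ k → 2ℚ ℚ.* δ (prev i) j ℚ.- (δ k j ℚ.+ δ (prev (prev i)) j)) (next-prev i)) ⟩
    _ ≡⟨ cancel (δ i j) (δ (next i) j) (δ (prev i) j) (δ (next (next i)) j) (δ (prev (prev i)) j) ⟩
    2ℚ ℚ.* δ i j ℚ.- (δ (next (next i)) j ℚ.+ δ (prev (prev i)) j) ∎
    where
    open ≡-Reasoning
    ℓ : Fin (size G) → ℚ
    ℓ k = laplacianℚ k j
    square : seq (sum (λ k → laplacian G i k * laplacian G k j)) n ≡ 2ℚ ℚ.* ℓ i ℚ.- (ℓ (next i) ℚ.+ ℓ (prev i))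
    square = trans (seq-sum (λ k → laplacian G i k * laplacian G k j) n)
      (trans (sum-cong-≗ (λ k → cong₂ ℚ._*_ (seq-laplacian i k n) (seq-laplacian k j n)))
        (∑-laplacianℚ i ℓ))
    cancel : ∀ d a b a′ b′ → let x = 2ℚ ℚ.* d ℚ.- (a ℚ.+ b) in
      (x ℚ.+ (x ℚ.+ (x ℚ.+ (x ℚ.+ 0ℚ)))) ℚ.-
        (2ℚ ℚ.* x ℚ.- ((2ℚ ℚ.* a ℚ.- (a′ ℚ.+ d)) ℚ.+ (2ℚ ℚ.* b ℚ.- (d ℚ.+ b′)))) ≡ 2ℚ ℚ.* d ℚ.- (a′ ℚ.+ b′)
    cancel = solve 5 (λ d a b a′ b′ → let x = con 2ℚ :* d :- (a :+ b) in
      (x :+ (x :+ (x :+ (x :+ con 0ℚ)))) :-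
        (con 2ℚ :* x :- ((con 2ℚ :* a :- (a′ :+ d)) :+ (con 2ℚ :* b :- (d :+ b′)))) := con 2ℚ :* d :- (a′ :+ b′)) refl
      where open +-*-Solver

-- Restriction of T(L) to the vectors supported on the old vertices.

module _ {G H : Graph} {C : Cyclic G} {D : Cyclic H} (E : Doubling C D) where
  private
    module C = Cyclic C
    module D = Cyclic D
  open Doubling E
  open ≡-Reasoning

  evenVectors : Subspace (size H)
  evenVectors = record
    { Member   = λ v → ∀ i → v (odd i) ≈ fromℕ 0
    ; resp     = λ {u} {v} u≈v u∈ i →
        ≈-trans {v (odd i)} {u (odd i)} {fromℕ 0} (≈-sym {u (odd i)} {v (odd i)} (u≈v (odd i))) (u∈ i)
    ; 0-closed = λ i → ≡⇒≈ {fromℕ 0} {fromℕ 0} (λ _ → refl)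
    ; +-closed = λ {u} {v} u∈ v∈ i → 0+0≈0 {u (odd i)} {v (odd i)} (u∈ i) (v∈ i)
    ; ·-closed = λ c {v} v∈ i → *0≈0 c {v (odd i)} (v∈ i)
    }

  evenBasis : Vector (Vector ℝ (size H)) (size G)
  evenBasis i x = fromℚ (δ (even i) x)

  δ-even : ∀ i j → δ (even i) (even j) ≡ δ i j
  δ-even i j with i ≟ᶠ j
  ... | yes refl = δ-≡ {i = even i} refl
  ... | no i≢j   = δ-≢ (i≢j ∘ even-injective)

  T-even-even : ∀ i j n → seq (T-laplacian D (even i) (even j)) n ≡ laplacianℚ C i j
  T-even-even i j n = begin
    seq (T-laplacian D (even i) (even j)) n
      ≡⟨ seq-T-laplacian D (even i) (even j) n ⟩
    2ℚ ℚ.* δ (even i) (even j) ℚ.- (δ (D.next (D.next (even i))) (even j) ℚ.+ δ (D.prev (D.prev (even i))) (even j))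
      ≡⟨ cong₂ (λ k l → 2ℚ ℚ.* δ (even i) (even j) ℚ.- (δ k (even j) ℚ.+ δ l (even j)))
           (trans (cong D.next (next-even i)) (next-odd i))
           (trans (cong D.prev (prev-even i)) (prev-odd (C.prev i))) ⟩
    2ℚ ℚ.* δ (even i) (even j) ℚ.- (δ (even (C.next i)) (even j) ℚ.+ δ (even (C.prev i)) (even j))
      ≡⟨ cong₂ (λ a b → 2ℚ ℚ.* a ℚ.- b) (δ-even i j) (cong₂ ℚ._+_ (δ-even (C.next i) j) (δ-even (C.prev i) j)) ⟩
    laplacianℚ C i j ∎

  -- Two steps in either direction preserve parity, so an odd row meets no even column. Both the
  -- invariance and the odd coordinates of the restriction rest on this.
  T-odd-even : ∀ i j n → seq (T-laplacian D (odd i) (even j)) n ≡ 0ℚ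
  T-odd-even i j n = begin
    seq (T-laplacian D (odd i) (even j)) n
      ≡⟨ seq-T-laplacian D (odd i) (even j) n ⟩
    2ℚ ℚ.* δ (odd i) (even j) ℚ.- (δ (D.next (D.next (odd i))) (even j) ℚ.+ δ (D.prev (D.prev (odd i))) (even j))
      ≡⟨ cong₂ (λ a b → 2ℚ ℚ.* a ℚ.- b) (δ-≢ odd≢even) (cong₂ ℚ._+_
           (δ-≢ (odd≢even ∘ trans (sym (trans (cong D.next (next-odd i)) (next-even (C.next i))))))
           (δ-≢ (odd≢even ∘ trans (sym (trans (cong D.prev (prev-odd i)) (prev-even i)))))) ⟩
    0ℚ ∎

  seq-linComb-even : ∀ (c : Vector ℝ (size G)) i n → seq (linComb c evenBasis (even i)) n ≡ seq (c i) n
  seq-linComb-even c i n = begin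
    seq (linComb c evenBasis (even i)) n                         ≡⟨ seq-sum (λ j → c j * evenBasis j (even i)) n ⟩
    ∑ (λ j → seq (c j) n ℚ.* δ (even j) (even i))                ≡⟨ sum-cong-≗ (λ j → trans (ℚ.*-comm (seq (c j) n) _)
                                                                      (cong (ℚ._* seq (c j) n) (trans (δ-even j i) (δ-sym j i)))) ⟩
    ∑ (λ j → δ i j ℚ.* seq (c j) n)                              ≡⟨ ∑-δ i (λ j → seq (c j) n) ⟩
    seq (c i) n                                                  ∎
    where
    δ-sym : ∀ j i → δ j i ≡ δ i j
    δ-sym j i with j ≟ᶠ i
    ... | yes j≡i = sym (δ-≡ (sym j≡i))
    ... | no j≢i  = sym (δ-≢ (j≢i ∘ sym))

  seq-linComb-odd : ∀ (c : Vector ℝ (size G)) i n → seq (linComb c evenBasis (odd i)) n ≡ 0ℚ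
  seq-linComb-odd c i n = trans (seq-sum (λ j → c j * evenBasis j (odd i)) n) (∑-zero λ j →
    trans (cong (seq (c j) n ℚ.*_) (δ-≢ (odd≢even ∘ sym))) (ℚ.*-zeroʳ (seq (c j) n)))

  on-halves : ∀ {p} (P : Pred (Fin (size H)) p) → (∀ i → P (even i)) → (∀ i → P (odd i)) → ∀ x → P x
  on-halves P onEven onOdd x with split x
  ... | inj₁ (i , refl) = onEven i
  ... | inj₂ (i , refl) = onOdd i

  -- Every summand in an odd row vanishes: in an even column because of the matrix entry, in an odd
  -- column because of the coordinate of `v`.
  evenVectors-invariant : Invariant (T-laplacian D) evenVectors
  evenVectors-invariant {v} v∈ i = sum≈0 (on-halves (λ x → T-laplacian D (odd i) x * v x ≈ fromℕ 0)
    (λ j → ≡⇒≈ {T-laplacian D (odd i) (even j) * v (even j)} {fromℕ 0} (λ n →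
      trans (cong (ℚ._* seq (v (even j)) n) (T-odd-even i j n)) (ℚ.*-zeroˡ (seq (v (even j)) n))))
    (λ j → *0≈0 (T-laplacian D (odd i) (odd j)) {v (odd j)} (v∈ j)))

  -- Evaluation at `even i` reads off the i-th coefficient, which gives the coefficients for
  -- spanning and proves independence.
  evenBasis-isBasis : IsBasis evenVectors evenBasis
  evenBasis-isBasis = record
    { member      = λ i j → ≡⇒≈ {evenBasis i (odd j)} {fromℕ 0} (λ _ → δ-≢ (odd≢even ∘ sym))
    ; spanning    = λ {v} v∈ → v ∘ even , on-halves (λ x → v x ≈ linComb (v ∘ even) evenBasis x)
        (λ i → ≡⇒≈ {v (even i)} {linComb (v ∘ even) evenBasis (even i)}
          (λ n → sym (seq-linComb-even (v ∘ even) i n)))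
        (λ i → ≈-trans {v (odd i)} {fromℕ 0} {linComb (v ∘ even) evenBasis (odd i)} (v∈ i)
          (≡⇒≈ {fromℕ 0} {linComb (v ∘ even) evenBasis (odd i)} (λ n → sym (seq-linComb-odd (v ∘ even) i n))))
    ; independent = λ c combination≈0 i →
        ≈-trans {c i} {linComb c evenBasis (even i)} {fromℕ 0}
          (≡⇒≈ {c i} {linComb c evenBasis (even i)} (λ n → sym (seq-linComb-even c i n)))
          (combination≈0 (even i))
    }

  T-laplacian-restricts : RestrictsTo (T-laplacian D) evenBasis (laplacian G)
  T-laplacian-restricts j = on-halves
    (λ x → (T-laplacian D · evenBasis j) x ≈ linComb (λ i → laplacian G i j) evenBasis x)
    (λ i → ≡⇒≈ {(T-laplacian D · evenBasis j) (even i)} {linComb (λ i → laplacian G i j) evenBasis (even i)} λ n → begin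
      seq ((T-laplacian D · evenBasis j) (even i)) n              ≡⟨ column (even i) n ⟩
      seq (T-laplacian D (even i) (even j)) n                     ≡⟨ T-even-even i j n ⟩
      laplacianℚ C i j                                            ≡⟨ seq-laplacian C i j n ⟨
      seq (laplacian G i j) n                                     ≡⟨ seq-linComb-even (λ i → laplacian G i j) i n ⟨
      seq (linComb (λ i → laplacian G i j) evenBasis (even i)) n  ∎)
    (λ i → ≡⇒≈ {(T-laplacian D · evenBasis j) (odd i)} {linComb (λ i → laplacian G i j) evenBasis (odd i)} λ n → begin
      seq ((T-laplacian D · evenBasis j) (odd i)) n               ≡⟨ column (odd i) n ⟩
      seq (T-laplacian D (odd i) (even j)) n                      ≡⟨ T-odd-even i j n ⟩
      0ℚ                                                          ≡⟨ seq-linComb-odd (λ i → laplacian G i j) i n ⟨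
      seq (linComb (λ i → laplacian G i j) evenBasis (odd i)) n   ∎)
    where
    column : ∀ x n → seq ((T-laplacian D · evenBasis j) x) n ≡ seq (T-laplacian D x (even j)) n
    column x n = begin
      seq ((T-laplacian D · evenBasis j) x) n                     ≡⟨ seq-sum (λ y → T-laplacian D x y * evenBasis j y) n ⟩
      ∑ (λ y → seq (T-laplacian D x y) n ℚ.* δ (even j) y)        ≡⟨ sum-cong-≗ (λ y → ℚ.*-comm (seq (T-laplacian D x y) n) (δ (even j) y)) ⟩
      ∑ (λ y → δ (even j) y ℚ.* seq (T-laplacian D x y) n)        ≡⟨ ∑-δ (even j) (λ y → seq (T-laplacian D x y) n) ⟩
      seq (T-laplacian D x (even j)) n                            ∎

barycentric-cyclic : ∀ {G} → Cyclic G → ∀ m → Cyclic (barycentric G m)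
barycentric-cyclic C zero    = C
barycentric-cyclic C (suc m) = refinement-cyclic (barycentric-cyclic C m)

-- Orbits of the quadratic map

ι : ℕ → ℚ
ι k = + k ℚ./ 1

0<*0< : ∀ {p q} → 0ℚ ℚ.< p → 0ℚ ℚ.< q → 0ℚ ℚ.< p ℚ.* q
0<*0< {p} {q} 0<p 0<q = ℚ.positive⁻¹ (p ℚ.* q) {{ℚ.pos*pos⇒pos p {{ℚ.positive 0<p}} q {{ℚ.positive 0<q}}}}

0≤*0≤ : ∀ {p q} → 0ℚ ℚ.≤ p → 0ℚ ℚ.≤ q → 0ℚ ℚ.≤ p ℚ.* q
0≤*0≤ {p} {q} 0≤p 0≤q = ℚ.nonNegative⁻¹ (p ℚ.* q)
  {{ℚ.nonNeg*nonNeg⇒nonNeg p {{ℚ.nonNegative 0≤p}} q {{ℚ.nonNegative 0≤q}}}}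

0≤+0≤ : ∀ {p q} → 0ℚ ℚ.≤ p → 0ℚ ℚ.≤ q → 0ℚ ℚ.≤ p ℚ.+ q
0≤+0≤ {p} {q} 0≤p 0≤q = ℚ.+-mono-≤ {0ℚ} {p} {0ℚ} {q} 0≤p 0≤q

0<+0≤ : ∀ {p q} → 0ℚ ℚ.< p → 0ℚ ℚ.≤ q → 0ℚ ℚ.< p ℚ.+ q
0<+0≤ {p} {q} 0<p 0≤q = ℚ.+-mono-<-≤ {0ℚ} {p} {0ℚ} {q} 0<p 0≤q

0≤square : ∀ p → 0ℚ ℚ.≤ p ℚ.* p
0≤square p with ℚ.≤-total 0ℚ p
... | inj₁ 0≤p = 0≤*0≤ 0≤p 0≤p
... | inj₂ p≤0 = ℚ.nonNegative⁻¹ (p ℚ.* p)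
  {{ℚ.nonPos*nonPos⇒nonPos p {{ℚ.nonPositive p≤0}} p {{ℚ.nonPositive p≤0}}}}

cancel-+ : ∀ p q → p ℚ.+ (q ℚ.- p) ≡ q
cancel-+ = solve 2 (λ p q → p :+ (q :- p) := q) refl
  where open +-*-Solver

≤⇒0≤ : ∀ {p q} → p ℚ.≤ q → 0ℚ ℚ.≤ q ℚ.- p
≤⇒0≤ {p} {q} p≤q = subst (ℚ._≤ q ℚ.- p) (ℚ.+-inverseʳ p) (ℚ.+-monoˡ-≤ (ℚ.- p) p≤q)

<⇒0< : ∀ {p q} → p ℚ.< q → 0ℚ ℚ.< q ℚ.- p
<⇒0< {p} {q} p<q = subst (ℚ._< q ℚ.- p) (ℚ.+-inverseʳ p) (ℚ.+-monoˡ-< (ℚ.- p) p<q)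

0≤⇒≤ : ∀ {p q r} → 0ℚ ℚ.≤ r → r ≡ q ℚ.- p → p ℚ.≤ q
0≤⇒≤ {p} {q} 0≤r refl = subst₂ ℚ._≤_ (ℚ.+-identityʳ p) (cancel-+ p q) (ℚ.+-monoʳ-≤ p 0≤r)

0<⇒< : ∀ {p q r} → 0ℚ ℚ.< r → r ≡ q ℚ.- p → p ℚ.< q
0<⇒< {p} {q} 0<r refl = subst₂ ℚ._<_ (ℚ.+-identityʳ p) (cancel-+ p q) (ℚ.+-monoʳ-< p 0<r)

square-mono-≤ : ∀ {p q} → 0ℚ ℚ.≤ p → p ℚ.≤ q → p ℚ.* p ℚ.≤ q ℚ.* q
square-mono-≤ {p} {q} 0≤p p≤q =
  0≤⇒≤ (0≤*0≤ (≤⇒0≤ p≤q) (0≤+0≤ 0≤p (ℚ.≤-trans 0≤p p≤q))) (factor p q)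
  where
  factor : ∀ p q → (q ℚ.- p) ℚ.* (p ℚ.+ q) ≡ q ℚ.* q ℚ.- p ℚ.* p
  factor = solve 2 (λ p q → (q :- p) :* (p :+ q) := q :* q :- p :* p) refl
    where open +-*-Solver

square-cancel-< : ∀ {p q} → 0ℚ ℚ.< q → p ℚ.* p ℚ.< q ℚ.* q → p ℚ.< q
square-cancel-< {p} {q} 0<q p²<q² with p ℚ.<? q
... | yes p<q = p<q
... | no p≮q  = contradiction
  (ℚ.<-≤-trans p²<q² (square-mono-≤ (ℚ.<⇒≤ 0<q) (ℚ.≮⇒≥ p≮q))) (ℚ.<-irrefl refl)

toℚᵘ-ι : ∀ k → ℚ.toℚᵘ (ι k) ℚᵘ.≃ ℚᵘ.mkℚᵘ (+ k) 0
toℚᵘ-ι k = ℚ.toℚᵘ-fromℚᵘ (ℚᵘ.mkℚᵘ (+ k) 0)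

ι-suc : ∀ k → ι (suc k) ≡ 1ℚ ℚ.+ ι k
ι-suc k = ℚ.toℚᵘ-injective (ℚᵘ.≃-trans (toℚᵘ-ι (suc k))
  (ℚᵘ.≃-sym (ℚᵘ.≃-trans (ℚ.toℚᵘ-homo-+ 1ℚ (ι k))
    (ℚᵘ.≃-trans (ℚᵘ.+-congʳ (ℚ.toℚᵘ 1ℚ) (toℚᵘ-ι k)) (ℚᵘ.*≡* (cong (ℤ._* + 1) eq))))))
  where
  eq : + 1 ℤ.* + 1 ℤ.+ + k ℤ.* + 1 ≡ + suc k
  eq = cong (λ m → + 1 ℤ.+ m) (ℤ.*-identityʳ (+ k))

0≤ι : ∀ k → 0ℚ ℚ.≤ ι k
0≤ι zero    = ℚ.≤-refl
0≤ι (suc k) = subst (0ℚ ℚ.≤_) (sym (ι-suc k)) (0≤+0≤ (ℚ.<⇒≤ (ℚ.positive⁻¹ 1ℚ)) (0≤ι k))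

-- The absolute value of the numerator is large enough, as the denominator is at least 1.
archimedean : ∀ q → ∃[ k ] q ℚ.≤ ι k
archimedean q@(mkℚ n d-1 _) = ℤ.∣ n ∣ , ℚ.toℚᵘ-cancel-≤
  (ℚᵘ.≤-respʳ-≃ (ℚᵘ.≃-sym (toℚᵘ-ι ℤ.∣ n ∣)) (ℚᵘ.*≤* (begin
    n ℤ.* + 1                 ≡⟨ ℤ.*-identityʳ n ⟩
    n                         ≤⟨ i≤∣i∣ n ⟩
    + ℤ.∣ n ∣                 ≤⟨ ℤ.+≤+ (ℕ.m≤m*n ℤ.∣ n ∣ (suc d-1)) ⟩
    + (ℤ.∣ n ∣ ℕ.* suc d-1)   ≡⟨ ℤ.pos-* ℤ.∣ n ∣ (suc d-1) ⟩
    + ℤ.∣ n ∣ ℤ.* + suc d-1   ∎)))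
  where
  open ℤ.≤-Reasoning
  i≤∣i∣ : ∀ i → i ℤ.≤ + ℤ.∣ i ∣
  i≤∣i∣ (+ m)      = ℤ.≤-refl
  i≤∣i∣ ℤ.-[1+ m ] = ℤ.-≤+

ℚ² : Set
ℚ² = ℚ × ℚ

-- Has term for term the shape of T on ℂ, so that it commutes by computation with
-- taking the n-th terms of the representing sequences.
Tℚ : ℚ² → ℚ²
Tℚ (a , b) =
  (a ℚ.+ (a ℚ.+ (a ℚ.+ (a ℚ.+ 0ℚ)))) ℚ.- (a ℚ.* a ℚ.- b ℚ.* b) ,
  (b ℚ.+ (b ℚ.+ (b ℚ.+ (b ℚ.+ 0ℚ)))) ℚ.- (a ℚ.* b ℚ.+ b ℚ.* a)

distance²ℚ : ℚ² → ℚ² → ℚ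
distance²ℚ (a , b) (c , d) = (a ℚ.- c) ℚ.* (a ℚ.- c) ℚ.+ (b ℚ.- d) ℚ.* (b ℚ.- d)

origin : ℚ²
origin = 0ℚ , 0ℚ

at : ℂ → ℕ → ℚ²
at z n = seq (re z) n , seq (im z) n

Tℂ : ℂ → ℂ
Tℂ = T ℂ-rawRing

at-iterate : ∀ z k n → at (iterate Tℂ z k) n ≡ iterate Tℚ (at z n) k
at-iterate z zero    n = refl
at-iterate z (suc k) n = at-iterate (Tℂ z) k n

-- With e = (ρ - ρ⁻¹)², squaring ρ gives (ρ² - ρ⁻²)² = (ρ - ρ⁻¹)² (ρ + ρ⁻¹)² = e (e + 4).
grow : ℚ → ℚ
grow e = e ℚ.* (e ℚ.+ 4ℚ)

-- For 0 < e, the exterior of the ellipse with foci 0 and 4 and squared semi-axes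
-- e + 4 and e, with denominators cleared. T carries it to the exterior of the
-- confocal ellipse of parameter grow e.
Outside : ℚ → ℚ² → Set
Outside e (a , b) = grow e ℚ.≤ (a ℚ.- 2ℚ) ℚ.* (a ℚ.- 2ℚ) ℚ.* e ℚ.+ b ℚ.* b ℚ.* (e ℚ.+ 4ℚ)

0≤4ℚ : 0ℚ ℚ.≤ 4ℚ
0≤4ℚ = ℚ.<⇒≤ (ℚ.positive⁻¹ 4ℚ)

grow-positive : ∀ {e} → 0ℚ ℚ.< e → 0ℚ ℚ.< grow e
grow-positive 0<e = 0<*0< 0<e (0<+0≤ 0<e 0≤4ℚ)

-- The slack of the conclusion is the slack of the hypothesis times a non-negative factor.
outside-T : ∀ {e} p → 0ℚ ℚ.< e → Outside e p → Outside (grow e) (Tℚ p)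
outside-T {e} (a , b) 0<e out = 0≤⇒≤
  (0≤*0≤ (≤⇒0≤ out)
    (0≤+0≤ (0≤+0≤ (0≤*0≤ (0≤square (a ℚ.- 2ℚ)) 0≤e+4) (0≤*0≤ (0≤square b) (ℚ.<⇒≤ 0<e)))
      (ℚ.<⇒≤ (grow-positive 0<e))))
  (slacks a b e)
  where
  0≤e+4 : 0ℚ ℚ.≤ e ℚ.+ 4ℚ
  0≤e+4 = 0≤+0≤ (ℚ.<⇒≤ 0<e) 0≤4ℚ
  slacks : ∀ a b e →
    let X  = (a ℚ.- 2ℚ) ℚ.* (a ℚ.- 2ℚ)
        Y  = b ℚ.* b
        g  = e ℚ.* (e ℚ.+ 4ℚ)
        a′ = (a ℚ.+ (a ℚ.+ (a ℚ.+ (a ℚ.+ 0ℚ)))) ℚ.- (a ℚ.* a ℚ.- b ℚ.* b)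
        b′ = (b ℚ.+ (b ℚ.+ (b ℚ.+ (b ℚ.+ 0ℚ)))) ℚ.- (a ℚ.* b ℚ.+ b ℚ.* a)
    in (X ℚ.* e ℚ.+ Y ℚ.* (e ℚ.+ 4ℚ) ℚ.- g) ℚ.* (X ℚ.* (e ℚ.+ 4ℚ) ℚ.+ Y ℚ.* e ℚ.+ g) ≡
       ((a′ ℚ.- 2ℚ) ℚ.* (a′ ℚ.- 2ℚ) ℚ.* g ℚ.+ b′ ℚ.* b′ ℚ.* (g ℚ.+ 4ℚ)) ℚ.- g ℚ.* (g ℚ.+ 4ℚ)
  slacks = solve 3 (λ a b e →
    let X  = (a :- con 2ℚ) :* (a :- con 2ℚ)
        Y  = b :* b
        g  = e :* (e :+ con 4ℚ)
        a′ = (a :+ (a :+ (a :+ (a :+ con 0ℚ)))) :- (a :* a :- b :* b)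
        b′ = (b :+ (b :+ (b :+ (b :+ con 0ℚ)))) :- (a :* b :+ b :* a)
    in (X :* e :+ Y :* (e :+ con 4ℚ) :- g) :* (X :* (e :+ con 4ℚ) :+ Y :* e :+ g) :=
       ((a′ :- con 2ℚ) :* (a′ :- con 2ℚ) :* g :+ b′ :* b′ :* (g :+ con 4ℚ)) :- g :* (g :+ con 4ℚ)) refl
    where open +-*-Solver

∥_∥² : ℚ² → ℚ
∥ p ∥² = distance²ℚ p origin

0≤2ℚ : 0ℚ ℚ.≤ 2ℚ
0≤2ℚ = ℚ.<⇒≤ (ℚ.positive⁻¹ 2ℚ)

Eventually : (ℕ → Set) → Set
Eventually P = ∃[ N ] ∀ n → N ℕ.≤ n → P n

both : ∀ {P Q : ℕ → Set} → Eventually P → Eventually Q → Eventually (λ n → P n × Q n)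
both (M , p) (N , q) = M ℕ.⊔ N , λ n ≤n → p n (ℕ.m⊔n≤o⇒m≤o M N ≤n) , q n (ℕ.m⊔n≤o⇒n≤o M N ≤n)

eventually-map : ∀ {P Q : ℕ → Set} → (∀ {n} → P n → Q n) → Eventually P → Eventually Q
eventually-map f (N , p) = N , λ n N≤n → f (p n N≤n)

outside-iterate : ∀ {e} p → 0ℚ ℚ.< e → Outside e p → ∀ k → Outside (iterate grow e k) (iterate Tℚ p k)
outside-iterate p 0<e out zero    = out
outside-iterate p 0<e out (suc k) =
  outside-iterate (Tℚ p) (grow-positive 0<e) (outside-T p 0<e out) k

iterate-positive : ∀ {e} → 0ℚ ℚ.< e → ∀ k → 0ℚ ℚ.< iterate grow e k
iterate-positive 0<e zero    = 0<e
iterate-positive 0<e (suc k) = iterate-positive (grow-positive 0<e) k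

-- The parameter more than quadruples at each step, but a linear lower bound already suffices for
-- the Archimedean argument. The induction varies `e`, since `iterate` applies the map to the
-- starting value first.
linear-growth : ∀ {e} → 0ℚ ℚ.< e → ∀ k → (1ℚ ℚ.+ ι k) ℚ.* e ℚ.≤ iterate grow e k
linear-growth {e} 0<e zero    = ℚ.≤-reflexive (ℚ.*-identityˡ e)
linear-growth {e} 0<e (suc k) = ℚ.≤-trans step (linear-growth (grow-positive 0<e) k)
  where
  0≤e : 0ℚ ℚ.≤ e
  0≤e = ℚ.<⇒≤ 0<e
  difference : ∀ t e → (1ℚ ℚ.+ t) ℚ.* (e ℚ.* (e ℚ.+ 2ℚ)) ℚ.+ t ℚ.* e ≡
    (1ℚ ℚ.+ t) ℚ.* (e ℚ.* (e ℚ.+ 4ℚ)) ℚ.- (1ℚ ℚ.+ (1ℚ ℚ.+ t)) ℚ.* e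
  difference = solve 2 (λ t e → (con 1ℚ :+ t) :* (e :* (e :+ con 2ℚ)) :+ t :* e :=
    (con 1ℚ :+ t) :* (e :* (e :+ con 4ℚ)) :- (con 1ℚ :+ (con 1ℚ :+ t)) :* e) refl
    where open +-*-Solver
  step : (1ℚ ℚ.+ ι (suc k)) ℚ.* e ℚ.≤ (1ℚ ℚ.+ ι k) ℚ.* grow e
  step = subst (λ t → (1ℚ ℚ.+ t) ℚ.* e ℚ.≤ (1ℚ ℚ.+ ι k) ℚ.* grow e) (sym (ι-suc k))
    (0≤⇒≤ (0≤+0≤
        (0≤*0≤ (0≤+0≤ (ℚ.<⇒≤ (ℚ.positive⁻¹ 1ℚ)) (0≤ι k)) (0≤*0≤ 0≤e (0≤+0≤ 0≤e 0≤2ℚ)))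
        (0≤*0≤ (0≤ι k) 0≤e))
      (difference (ι k) e))

unbounded-growth : ∀ {e} → 0ℚ ℚ.< e → ∀ B → ∃[ k ] B ℚ.< iterate grow e k
unbounded-growth {e} 0<e B = k , (begin-strict
    B                          ≡⟨ ℚ.*-identityʳ B ⟨
    B ℚ.* 1ℚ                   ≡⟨ cong (B ℚ.*_) (ℚ.*-inverseˡ e) ⟨
    B ℚ.* (ℚ.1/ e ℚ.* e)       ≡⟨ ℚ.*-assoc B (ℚ.1/ e) e ⟨
    B ℚ.* ℚ.1/ e ℚ.* e         ≤⟨ ℚ.*-monoʳ-≤-nonNeg e B/e≤k ⟩
    ι k ℚ.* e                  <⟨ 0<⇒< 0<e (difference (ι k) e) ⟩
    (1ℚ ℚ.+ ι k) ℚ.* e         ≤⟨ linear-growth 0<e k ⟩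
    iterate grow e k           ∎)
  where
  open ℚ.≤-Reasoning
  instance
    e-pos : ℚ.Positive e
    e-pos = ℚ.positive 0<e
    e-nonNeg : ℚ.NonNegative e
    e-nonNeg = ℚ.pos⇒nonNeg e
    e≢0 : ℚ.NonZero e
    e≢0 = ℚ.pos⇒nonZero e
  k : ℕ
  k = proj₁ (archimedean (B ℚ.* ℚ.1/ e))
  B/e≤k : B ℚ.* ℚ.1/ e ℚ.≤ ι k
  B/e≤k = proj₂ (archimedean (B ℚ.* ℚ.1/ e))
  difference : ∀ t e → e ≡ (1ℚ ℚ.+ t) ℚ.* e ℚ.- t ℚ.* e
  difference = solve 2 (λ t e → e := (con 1ℚ :+ t) :* e :- t :* e) refl
    where open +-*-Solver

-- The shorter semi-axis is the square root of e, so a point outside satisfies (a - 2)² + b² ≥ e.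
-- The identity (a - 2)² + (a + 2)² = 2a² + 8 moves the centre from 2 to the origin and yields the
-- constants 2 and 8.
outside-norm : ∀ {e} p → 0ℚ ℚ.< e → Outside e p → e ℚ.≤ 2ℚ ℚ.* ∥ p ∥² ℚ.+ 8ℚ
outside-norm {e} p@(a , b) 0<e out = ℚ.*-cancelˡ-≤-pos (e ℚ.+ 4ℚ) {{ℚ.positive 0<e+4}}
  (0≤⇒≤ (0≤+0≤ (≤⇒0≤ out) (0≤+0≤ (0≤*0≤ 0≤4ℚ (0≤square (a ℚ.- 2ℚ)))
      (0≤*0≤ (ℚ.<⇒≤ 0<e+4) (0≤+0≤ (0≤square (a ℚ.+ 2ℚ)) (0≤square b)))))
    (difference a b e))
  where
  0<e+4 : 0ℚ ℚ.< e ℚ.+ 4ℚ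
  0<e+4 = 0<+0≤ 0<e 0≤4ℚ
  difference : ∀ a b e →
    let X = (a ℚ.- 2ℚ) ℚ.* (a ℚ.- 2ℚ)
        Y = b ℚ.* b
    in (X ℚ.* e ℚ.+ Y ℚ.* (e ℚ.+ 4ℚ) ℚ.- e ℚ.* (e ℚ.+ 4ℚ))
         ℚ.+ (4ℚ ℚ.* X ℚ.+ (e ℚ.+ 4ℚ) ℚ.* ((a ℚ.+ 2ℚ) ℚ.* (a ℚ.+ 2ℚ) ℚ.+ Y)) ≡
       (e ℚ.+ 4ℚ) ℚ.* (2ℚ ℚ.* ((a ℚ.- 0ℚ) ℚ.* (a ℚ.- 0ℚ) ℚ.+ (b ℚ.- 0ℚ) ℚ.* (b ℚ.- 0ℚ)) ℚ.+ 8ℚ)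
         ℚ.- (e ℚ.+ 4ℚ) ℚ.* e
  difference = solve 3 (λ a b e →
    let X = (a :- con 2ℚ) :* (a :- con 2ℚ)
        Y = b :* b
    in (X :* e :+ Y :* (e :+ con 4ℚ) :- e :* (e :+ con 4ℚ))
         :+ (con 4ℚ :* X :+ (e :+ con 4ℚ) :* ((a :+ con 2ℚ) :* (a :+ con 2ℚ) :+ Y)) :=
       (e :+ con 4ℚ) :* (con 2ℚ :* ((a :- con 0ℚ) :* (a :- con 0ℚ) :+ (b :- con 0ℚ) :* (b :- con 0ℚ)) :+ con 8ℚ)
         :- (e :+ con 4ℚ) :* e) refl
    where open +-*-Solver

∣p∣≤q⇒p²≤q² : ∀ {p q} → ∣ p ∣ ℚ.≤ q → p ℚ.* p ℚ.≤ q ℚ.* q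
∣p∣≤q⇒p²≤q² {p} {q} p≤q = subst (ℚ._≤ q ℚ.* q) ∣p∣²≡p² (square-mono-≤ (ℚ.0≤∣p∣ p) p≤q)
  where
  ∣p∣²≡p² : ∣ p ∣ ℚ.* ∣ p ∣ ≡ p ℚ.* p
  ∣p∣²≡p² with ℚ.∣p∣≡p∨∣p∣≡-p p
  ... | inj₁ eq = cong₂ ℚ._*_ eq eq
  ... | inj₂ eq = trans (cong₂ ℚ._*_ eq eq)
    (solve 1 (λ p → (:- p) :* (:- p) := p :* p) refl p)
    where open +-*-Solver

outside⇒¬filled : ∀ {e} z → 0ℚ ℚ.< e → Eventually (λ n → Outside e (at z n)) → ¬ FilledJulia Tℂ z
outside⇒¬filled {e} z 0<e out (r , bounded) = ℚ.<-irrefl refl (begin-strict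
    2ℚ ℚ.* (B ℚ.* B ℚ.+ 1ℚ) ℚ.+ 8ℚ        <⟨ large ⟩
    iterate grow e k                       ≤⟨ outside-norm (iterate Tℚ (at z n) k) (iterate-positive 0<e k)
                                                (outside-iterate (at z n) 0<e (proj₁ (proj₁ facts)) k) ⟩
    2ℚ ℚ.* ∥ iterate Tℚ (at z n) k ∥² ℚ.+ 8ℚ
                                           ≤⟨ ℚ.+-monoˡ-≤ 8ℚ (ℚ.*-monoˡ-≤-nonNeg 2ℚ norm≤) ⟩
    2ℚ ℚ.* (B ℚ.* B ℚ.+ 1ℚ) ℚ.+ 8ℚ        ∎)
  where
  open ℚ.≤-Reasoning
  r-bound = eventuallyBounded r
  B = proj₁ r-bound
  -- The number of iterations depends only on `e` and on the bound `B` for the terms of `r`; the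
  -- index `n` comes afterwards, because the estimate from `bounded k` starts at an index depending
  -- on `k`. The summand `1ℚ` is the tolerance at which that estimate is read.
  k = proj₁ (unbounded-growth 0<e (2ℚ ℚ.* (B ℚ.* B ℚ.+ 1ℚ) ℚ.+ 8ℚ))
  large = proj₂ (unbounded-growth 0<e (2ℚ ℚ.* (B ℚ.* B ℚ.+ 1ℚ) ℚ.+ 8ℚ))
  simultaneously : Eventually (λ n → (Outside e (at z n) × ∣ seq r n ∣ ℚ.≤ B) ×
    ∥ at (iterate Tℂ z k) n ∥² ℚ.< seq r n ℚ.* seq r n ℚ.+ 1ℚ)
  simultaneously = both (both out (proj₂ (proj₂ r-bound))) (bounded k 1ℚ (ℚ.positive⁻¹ 1ℚ))
  n = proj₁ simultaneously
  facts = proj₂ simultaneously n ℕ.≤-refl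
  norm≤ : ∥ iterate Tℚ (at z n) k ∥² ℚ.≤ B ℚ.* B ℚ.+ 1ℚ
  norm≤ = subst (λ p → ∥ p ∥² ℚ.≤ B ℚ.* B ℚ.+ 1ℚ) (at-iterate z k n)
    (ℚ.≤-trans (ℚ.<⇒≤ (proj₂ facts)) (ℚ.+-monoˡ-≤ 1ℚ (∣p∣≤q⇒p²≤q² (proj₂ (proj₁ facts)))))

-- The ellipse is contained in the strip b² ≤ e, just as `real-outside` uses that it is contained in
-- (a - 2)² ≤ e + 4.
imaginary-outside : ∀ {e} a b → 0ℚ ℚ.< e → e ℚ.≤ b ℚ.* b → Outside e (a , b)
imaginary-outside {e} a b 0<e e≤b² = 0≤⇒≤
  (0≤+0≤ (0≤*0≤ (0≤square (a ℚ.- 2ℚ)) (ℚ.<⇒≤ 0<e))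
         (0≤*0≤ (≤⇒0≤ e≤b²) (0≤+0≤ (ℚ.<⇒≤ 0<e) 0≤4ℚ)))
  (difference ((a ℚ.- 2ℚ) ℚ.* (a ℚ.- 2ℚ)) (b ℚ.* b) e)
  where
  difference : ∀ X Y e → X ℚ.* e ℚ.+ (Y ℚ.- e) ℚ.* (e ℚ.+ 4ℚ) ≡
    (X ℚ.* e ℚ.+ Y ℚ.* (e ℚ.+ 4ℚ)) ℚ.- e ℚ.* (e ℚ.+ 4ℚ)
  difference = solve 3 (λ X Y e → X :* e :+ (Y :- e) :* (e :+ con 4ℚ) :=
    (X :* e :+ Y :* (e :+ con 4ℚ)) :- e :* (e :+ con 4ℚ)) refl
    where open +-*-Solver

real-outside : ∀ {e} a b → 0ℚ ℚ.< e → e ℚ.+ 4ℚ ℚ.≤ (a ℚ.- 2ℚ) ℚ.* (a ℚ.- 2ℚ) → Outside e (a , b)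
real-outside {e} a b 0<e far = 0≤⇒≤
  (0≤+0≤ (0≤*0≤ (≤⇒0≤ far) (ℚ.<⇒≤ 0<e))
         (0≤*0≤ (0≤square b) (0≤+0≤ (ℚ.<⇒≤ 0<e) 0≤4ℚ)))
  (difference ((a ℚ.- 2ℚ) ℚ.* (a ℚ.- 2ℚ)) (b ℚ.* b) e)
  where
  difference : ∀ X Y e → (X ℚ.- (e ℚ.+ 4ℚ)) ℚ.* e ℚ.+ Y ℚ.* (e ℚ.+ 4ℚ) ≡
    (X ℚ.* e ℚ.+ Y ℚ.* (e ℚ.+ 4ℚ)) ℚ.- e ℚ.* (e ℚ.+ 4ℚ)
  difference = solve 3 (λ X Y e → (X :- (e :+ con 4ℚ)) :* e :+ Y :* (e :+ con 4ℚ) :=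
    (X :* e :+ Y :* (e :+ con 4ℚ)) :- e :* (e :+ con 4ℚ)) refl
    where open +-*-Solver

-- The Julia set lies in [0,4].

p≤∣p∣ : ∀ p → p ℚ.≤ ∣ p ∣
p≤∣p∣ p with ℚ.≤-total 0ℚ p
... | inj₁ 0≤p = ℚ.≤-reflexive (sym (ℚ.0≤p⇒∣p∣≡p 0≤p))
... | inj₂ p≤0 = ℚ.≤-trans p≤0 (ℚ.0≤∣p∣ p)

∣p∣<q : ∀ {p q} → p ℚ.< q → ℚ.- p ℚ.< q → ∣ p ∣ ℚ.< q
∣p∣<q {p} {q} p<q -p<q with ℚ.∣p∣≡p∨∣p∣≡-p p
... | inj₁ eq = subst (ℚ._< q) (sym eq) p<q
... | inj₂ eq = subst (ℚ._< q) (sym eq) -p<q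

0<+0< : ∀ {p q} → 0ℚ ℚ.< p → 0ℚ ℚ.< q → 0ℚ ℚ.< p ℚ.+ q
0<+0< 0<p 0<q = 0<+0≤ 0<p (ℚ.<⇒≤ 0<q)

-- Decided by comparing q with a single late term of x.
≯⇒≤ : ∀ x q → (∀ {η} → 0ℚ ℚ.< η → ¬ Eventually (λ n → q ℚ.+ η ℚ.< seq x n)) → x ≤ fromℚ q
≯⇒≤ x q ≯ ε 0<ε = conclude (seq x N ℚ.<? q ℚ.+ (η ℚ.+ η))
  where
  η = ½ ℚ.* (½ ℚ.* ε)
  0<η : 0ℚ ℚ.< η
  0<η = half-positive (half-positive 0<ε)
  N = proj₁ (cauchy x η 0<η)
  close = proj₂ (cauchy x η 0<η)
  open +-*-Solver
  conclude : _ → Eventually (λ n → seq x n ℚ.< q ℚ.+ ε)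
  conclude (yes xN<) = N , λ n N≤n → 0<⇒<
    (0<+0< (0<+0< (<⇒0< xN<) (<⇒0< (ℚ.≤-<-trans (p≤∣p∣ _) (close n N N≤n ℕ.≤-refl)))) 0<η)
    (solve 4 (λ q ε xN xn → let η = con ½ :* (con ½ :* ε) in
      ((q :+ (η :+ η) :- xN) :+ (η :- (xn :- xN))) :+ η := (q :+ ε) :- xn) refl q ε (seq x N) (seq x n))
  conclude (no xN≮) = contradiction
    (N , λ n N≤n → 0<⇒<
      (0<+0≤ (<⇒0< (ℚ.≤-<-trans (p≤∣p∣ _) (close N n ℕ.≤-refl N≤n))) (≤⇒0≤ (ℚ.≮⇒≥ xN≮)))
      (solve 4 (λ q η xN xn → (η :- (xN :- xn)) :+ (xN :- (q :+ (η :+ η))) := xn :- (q :+ η))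
        refl q η (seq x N) (seq x n)))
    (≯ 0<η)

square-neg : ∀ p q → (q ℚ.- p) ℚ.* (q ℚ.- p) ≡ (p ℚ.- q) ℚ.* (p ℚ.- q)
square-neg = solve 2 (λ p q → (q :- p) :* (q :- p) := (p :- q) :* (p :- q)) refl
  where open +-*-Solver

coordinates-close : ∀ {r} p q → 0ℚ ℚ.< r → distance²ℚ p q ℚ.< r ℚ.* r →
  (proj₁ p ℚ.- proj₁ q ℚ.< r × proj₁ q ℚ.- proj₁ p ℚ.< r) ×
  (proj₂ p ℚ.- proj₂ q ℚ.< r × proj₂ q ℚ.- proj₂ p ℚ.< r)
coordinates-close {r} (a , b) (c , d) 0<r close =
  (square-cancel-< 0<r re< , square-cancel-< 0<r (subst (ℚ._< r ℚ.* r) (sym (square-neg a c)) re<)) ,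
  (square-cancel-< 0<r im< , square-cancel-< 0<r (subst (ℚ._< r ℚ.* r) (sym (square-neg b d)) im<))
  where
  re< : (a ℚ.- c) ℚ.* (a ℚ.- c) ℚ.< r ℚ.* r
  re< = ℚ.≤-<-trans (0≤⇒≤ (0≤square (b ℚ.- d))
    (solve 2 (λ x y → y := (x :+ y) :- x) refl ((a ℚ.- c) ℚ.* (a ℚ.- c)) ((b ℚ.- d) ℚ.* (b ℚ.- d)))) close
    where open +-*-Solver
  im< : (b ℚ.- d) ℚ.* (b ℚ.- d) ℚ.< r ℚ.* r
  im< = ℚ.≤-<-trans (0≤⇒≤ (0≤square (a ℚ.- c))
    (solve 2 (λ x y → x := (x :+ y) :- y) refl ((a ℚ.- c) ℚ.* (a ℚ.- c)) ((b ℚ.- d) ℚ.* (b ℚ.- d)))) close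
    where open +-*-Solver

-- Being in the Julia set provides filled points near `z` and says nothing about the orbit of `z`
-- itself. Escape is therefore required on a whole disc, with one `e` for all its points and all
-- late indices.
julia⇒¬outside-nearby : ∀ {z e r} → Julia Tℂ z → 0ℚ ℚ.< e → 0ℚ ℚ.< r →
  ¬ Eventually (λ n → ∀ p → distance²ℚ p (at z n) ℚ.< r ℚ.* r → Outside e p)
julia⇒¬outside-nearby {z} {e} {r} julia 0<e 0<r nearby =
  let w , (ε , 0<ε , close) , filled = proj₁ (julia (fromℚ r) 0<fromℚr)
  in outside⇒¬filled w 0<e
       (eventually-map (λ {n} (near⇒outside , d<) → near⇒outside (at w n) (ℚ.≤-<-trans (≤+ε 0<ε) d<))
         (both nearby close))
       filled
  where
  open +-*-Solver
  0<fromℚr : fromℕ 0 < fromℚ r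
  0<fromℚr = ½ ℚ.* r , half-positive 0<r , 0 , λ _ _ → 0<⇒< (half-positive 0<r)
    (solve 1 (λ r → con ½ :* r := r :- (con 0ℚ :+ con ½ :* r)) refl r)
  ≤+ε : ∀ {d ε} → 0ℚ ℚ.< ε → d ℚ.≤ d ℚ.+ ε
  ≤+ε {d} {ε} 0<ε = 0≤⇒≤ (ℚ.<⇒≤ 0<ε) (solve 2 (λ d ε → ε := (d :+ ε) :- d) refl d ε)

-- Taking `t` as a - 2 or as 2 - a treats both ends of the interval. The bound holds since (2 + h)²
-- exceeds h + 4 by h (3 + h).
far-outside : ∀ {h} a b t → 0ℚ ℚ.< h → 2ℚ ℚ.+ h ℚ.≤ t → t ℚ.* t ≡ (a ℚ.- 2ℚ) ℚ.* (a ℚ.- 2ℚ) → Outside h (a , b)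
far-outside {h} a b t 0<h far eq = real-outside a b 0<h
  (subst (h ℚ.+ 4ℚ ℚ.≤_) eq (ℚ.≤-trans
    (0≤⇒≤ (0≤*0≤ (ℚ.<⇒≤ 0<h) (0≤+0≤ (ℚ.<⇒≤ (ℚ.positive⁻¹ (1ℚ ℚ.+ 2ℚ))) (ℚ.<⇒≤ 0<h)))
      (solve 1 (λ h → h :* (con (1ℚ ℚ.+ 2ℚ) :+ h) := (con 2ℚ :+ h) :* (con 2ℚ :+ h) :- (h :+ con 4ℚ)) refl h))
    (square-mono-≤ (0≤+0≤ 0≤2ℚ (ℚ.<⇒≤ 0<h)) far)))
  where open +-*-Solver

-- Each of the four bounds is obtained by refuting an excess `η`: one half of it is the radius of a
-- disc about `z`, and the other half still separates that disc from the interval or the axis.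
julia⇒interval : ∀ z → Julia Tℂ z → realInterval (fromℕ 0) (fromℕ 4) z
julia⇒interval z julia = im≈0 , 0≤re , ≯⇒≤ (re z) 4ℚ re≯4
  where
  open +-*-Solver

  re≯4 : ∀ {η} → 0ℚ ℚ.< η → ¬ Eventually (λ n → 4ℚ ℚ.+ η ℚ.< seq (re z) n)
  re≯4 {η} 0<η above = julia⇒¬outside-nearby {z} julia 0<h 0<h
    (eventually-map (λ {n} c> p@(a , b) close →
      far-outside a b (a ℚ.- 2ℚ) 0<h
        (ℚ.<⇒≤ (0<⇒< (0<+0< (<⇒0< c>) (<⇒0< (proj₂ (proj₁ (coordinates-close p (at z n) 0<h close)))))
          (solve 3 (λ a c η → (c :- (con 4ℚ :+ η)) :+ (con ½ :* η :- (c :- a)) :=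
            (a :- con 2ℚ) :- (con 2ℚ :+ con ½ :* η)) refl a (seq (re z) n) η)))
        refl) above)
    where
    0<h : 0ℚ ℚ.< ½ ℚ.* η
    0<h = half-positive 0<η

  -re≯0 : ∀ {η} → 0ℚ ℚ.< η → ¬ Eventually (λ n → 0ℚ ℚ.+ η ℚ.< ℚ.- seq (re z) n)
  -re≯0 {η} 0<η below = julia⇒¬outside-nearby {z} julia 0<h 0<h
    (eventually-map (λ {n} c< p@(a , b) close →
      far-outside a b (2ℚ ℚ.- a) 0<h
        (ℚ.<⇒≤ (0<⇒< (0<+0< (<⇒0< c<) (<⇒0< (proj₁ (proj₁ (coordinates-close p (at z n) 0<h close)))))
          (solve 3 (λ a c η → (:- c :- (con 0ℚ :+ η)) :+ (con ½ :* η :- (a :- c)) :=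
            (con 2ℚ :- a) :- (con 2ℚ :+ con ½ :* η)) refl a (seq (re z) n) η)))
        (square-neg a 2ℚ)) below)
    where
    0<h : 0ℚ ℚ.< ½ ℚ.* η
    0<h = half-positive 0<η

  im≯0 : ∀ {η} → 0ℚ ℚ.< η → ¬ Eventually (λ n → 0ℚ ℚ.+ η ℚ.< seq (im z) n)
  -- The parameter is the square of h, because the strip around the ellipse has the square root of
  -- the parameter as its half-width.
  im≯0 {η} 0<η above = julia⇒¬outside-nearby {z} julia (0<*0< 0<h 0<h) 0<h
    (eventually-map (λ {n} d> p@(a , b) close →
      imaginary-outside a b (0<*0< 0<h 0<h) (square-mono-≤ {q = b} (ℚ.<⇒≤ 0<h)
        (ℚ.<⇒≤ (0<⇒< (0<+0< (<⇒0< d>) (<⇒0< (proj₂ (proj₂ (coordinates-close p (at z n) 0<h close)))))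
          (solve 3 (λ b d η → (d :- (con 0ℚ :+ η)) :+ (con ½ :* η :- (d :- b)) :=
            b :- con ½ :* η) refl b (seq (im z) n) η))))) above)
    where
    0<h : 0ℚ ℚ.< ½ ℚ.* η
    0<h = half-positive 0<η

  -im≯0 : ∀ {η} → 0ℚ ℚ.< η → ¬ Eventually (λ n → 0ℚ ℚ.+ η ℚ.< ℚ.- seq (im z) n)
  -im≯0 {η} 0<η below = julia⇒¬outside-nearby {z} julia (0<*0< 0<h 0<h) 0<h
    (eventually-map (λ {n} d< p@(a , b) close →
      imaginary-outside a b (0<*0< 0<h 0<h) (subst (½ ℚ.* η ℚ.* (½ ℚ.* η) ℚ.≤_) (-b*-b b)
        (square-mono-≤ {q = ℚ.- b} (ℚ.<⇒≤ 0<h)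
          (ℚ.<⇒≤ (0<⇒< (0<+0< (<⇒0< d<) (<⇒0< (proj₁ (proj₂ (coordinates-close p (at z n) 0<h close)))))
            (solve 3 (λ b d η → (:- d :- (con 0ℚ :+ η)) :+ (con ½ :* η :- (b :- d)) :=
              :- b :- con ½ :* η) refl b (seq (im z) n) η)))))) below)
    where
    0<h : 0ℚ ℚ.< ½ ℚ.* η
    0<h = half-positive 0<η
    -b*-b : ∀ b → (ℚ.- b) ℚ.* (ℚ.- b) ≡ b ℚ.* b
    -b*-b = solve 1 (λ b → (:- b) :* (:- b) := b :* b) refl

  0≤re : fromℕ 0 ≤ re z
  0≤re ε 0<ε = eventually-map (λ {n} -c<ε → 0<⇒< (<⇒0< -c<ε)
      (solve 2 (λ c ε → (con 0ℚ :+ ε) :- :- c := (c :+ ε) :- con 0ℚ) refl (seq (re z) n) ε))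
    (≯⇒≤ (- re z) 0ℚ -re≯0 ε 0<ε)

  im≈0 : im z ≈ fromℕ 0
  im≈0 ε 0<ε = eventually-map
    (λ {n} (d<ε , -d<ε) → ∣p∣<q {q = ε}
      (subst₂ ℚ._<_ (sym (ℚ.+-identityʳ (seq (im z) n))) (ℚ.+-identityˡ ε) d<ε)
      (subst₂ ℚ._<_ (cong ℚ.-_ (sym (ℚ.+-identityʳ (seq (im z) n)))) (ℚ.+-identityˡ ε) -d<ε))
    (both (≯⇒≤ (im z) 0ℚ im≯0 ε 0<ε) (≯⇒≤ (- im z) 0ℚ -im≯0 ε 0<ε))

-- The interval lies in the Julia set.

InInterval : ℚ² → Set
InInterval (a , b) = (0ℚ ℚ.≤ a × a ℚ.≤ 4ℚ) × b ≡ 0ℚ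

-- On the real axis T(a) = a (4 - a) and 4 - T(a) = (a - 2)².
interval-T : ∀ p → InInterval p → InInterval (Tℚ p)
interval-T (a , _) ((0≤a , a≤4) , refl) =
  ( 0≤⇒≤ (0≤*0≤ 0≤a (≤⇒0≤ a≤4))
      (solve 1 (λ a → a :* (con 4ℚ :- a) := T-re a :- con 0ℚ) refl a)
  , 0≤⇒≤ (0≤square (a ℚ.- 2ℚ))
      (solve 1 (λ a → (a :- con 2ℚ) :* (a :- con 2ℚ) := con 4ℚ :- T-re a) refl a)) ,
  solve 1 (λ a → con 0ℚ :- (a :* con 0ℚ :+ con 0ℚ :* a) := con 0ℚ) refl a
  where
  open +-*-Solver
  T-re : ∀ {n} → Polynomial n → Polynomial n
  T-re a = (a :+ (a :+ (a :+ (a :+ con 0ℚ)))) :- (a :* a :- con 0ℚ :* con 0ℚ)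

interval-iterate : ∀ p → InInterval p → ∀ k → InInterval (iterate Tℚ p k)
interval-iterate p p∈ zero    = p∈
interval-iterate p p∈ (suc k) = interval-iterate (Tℚ p) (interval-T p p∈) k

interval-norm : ∀ p → InInterval p → ∥ p ∥² ℚ.≤ 4ℚ ℚ.* 4ℚ
interval-norm (a , _) ((0≤a , a≤4) , refl) = ℚ.≤-trans (ℚ.≤-reflexive
    (solve 1 (λ a → (a :- con 0ℚ) :* (a :- con 0ℚ) :+ con 0ℚ := a :* a) refl a))
  (square-mono-≤ 0≤a a≤4)
  where open +-*-Solver

rational : ℚ² → ℂ
rational (a , b) = fromℚ a +i fromℚ b

interval-filled : ∀ p → InInterval p → FilledJulia Tℂ (rational p)
interval-filled p p∈ = fromℕ 4 , λ k ε 0<ε → 0 , λ n _ →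
  subst (λ q → ∥ q ∥² ℚ.< 4ℚ ℚ.* 4ℚ ℚ.+ ε) (sym (at-iterate (rational p) k n))
    (ℚ.≤-<-trans (interval-norm (iterate Tℚ p k) (interval-iterate p p∈ k))
      (0<⇒< 0<ε (solve 2 (λ x ε → ε := (x :+ ε) :- x) refl (4ℚ ℚ.* 4ℚ) ε)))
  where open +-*-Solver

off-axis-¬filled : ∀ a {b} → 0ℚ ℚ.< b → ¬ FilledJulia Tℂ (rational (a , b))
off-axis-¬filled a {b} 0<b = outside⇒¬filled (rational (a , b)) (0<*0< 0<b 0<b)
  (0 , λ _ _ → imaginary-outside a b (0<*0< 0<b 0<b) ℚ.≤-refl)

clamp : ∀ {x η} → 0ℚ ℚ.< x ℚ.+ η → x ℚ.< 4ℚ ℚ.+ η → 0ℚ ℚ.< η →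
  ∃[ a ] (0ℚ ℚ.≤ a × a ℚ.≤ 4ℚ) × ∣ a ℚ.- x ∣ ℚ.< η
clamp {x} {η} 0<x+η x<4+η 0<η with 0ℚ ℚ.≤? x | x ℚ.≤? 4ℚ
... | yes 0≤x | yes x≤4 = x , (0≤x , x≤4) , subst (λ p → ∣ p ∣ ℚ.< η) (sym (ℚ.+-inverseʳ x)) 0<η
... | no 0≰x | _ = 0ℚ , (ℚ.≤-refl , 0≤4ℚ) , ∣p∣<q
  (0<⇒< 0<x+η (solve 2 (λ x η → x :+ η := η :- (con 0ℚ :- x)) refl x η))
  (0<⇒< (0<+0< 0<η (<⇒0< (ℚ.≰⇒> 0≰x)))
    (solve 2 (λ x η → η :+ (con 0ℚ :- x) := η :- :- (con 0ℚ :- x)) refl x η))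
  where open +-*-Solver
... | yes _ | no x≰4 = 4ℚ , (0≤4ℚ , ℚ.≤-refl) , ∣p∣<q
  (0<⇒< (0<+0< 0<η (<⇒0< (ℚ.≰⇒> x≰4)))
    (solve 2 (λ x η → η :+ (x :- con 4ℚ) := η :- (con 4ℚ :- x)) refl x η))
  (0<⇒< (<⇒0< x<4+η) (solve 2 (λ x η → (con 4ℚ :+ η) :- x := η :- :- (con 4ℚ :- x)) refl x η))
  where open +-*-Solver

-- A late term of `re z` is within h/2 of the interval, and clamping it costs less than h/2; the
-- later terms stay within another h/2 of it. The imaginary part is held to h/2 to leave room for a
-- vertical displacement.
interval-approximation : ∀ z → realInterval (fromℕ 0) (fromℕ 4) z → ∀ {h} → 0ℚ ℚ.< h →
  ∃[ a ] (0ℚ ℚ.≤ a × a ℚ.≤ 4ℚ) × Eventually (λ n → ∣ a ℚ.- seq (re z) n ∣ ℚ.< h × ∣ seq (im z) n ∣ ℚ.< ½ ℚ.* h)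
interval-approximation z (im≈0 , 0≤re , re≤4) {h} 0<h =
  let M , bounds = both (0≤re η 0<η) (re≤4 η 0<η)
      N , close  = cauchy (re z) η 0<η
      K          = M ℕ.⊔ N
      0<x+η , x<4+η = bounds K (ℕ.m≤m⊔n M N)
      a , a∈ , near = clamp {seq (re z) K} 0<x+η x<4+η 0<η
  in a , a∈ , both
       (K , λ n K≤n → subst (λ p → ∣ p ∣ ℚ.< h) (telescope a (seq (re z) K) (seq (re z) n))
         (∣+∣<½+½ {a ℚ.- seq (re z) K} {seq (re z) K ℚ.- seq (re z) n} near
           (close K n (ℕ.m≤n⊔m M N) (ℕ.≤-trans (ℕ.m≤n⊔m M N) K≤n))))
       (eventually-map (λ {n} → subst (λ p → ∣ p ∣ ℚ.< η) (ℚ.+-identityʳ (seq (im z) n))) (im≈0 η 0<η))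
  where
  η = ½ ℚ.* h
  0<η : 0ℚ ℚ.< η
  0<η = half-positive 0<h

-- The interval has empty interior in the plane: one rational `a` gives both witnesses, at height 0
-- a filled point and at the small height h/2/2 a point whose orbit escapes.
interval⇒julia : ∀ z → realInterval (fromℕ 0) (fromℕ 4) z → Julia Tℂ z
interval⇒julia z z∈ r (ε , 0<ε , ε<r) =
  (rational (a , 0ℚ) , near (ℚ.≤-refl) 0<½h , interval-filled (a , 0ℚ) (a∈ , refl)) ,
  (rational (a , ½ ℚ.* (½ ℚ.* h)) , near (ℚ.<⇒≤ (half-positive 0<½h)) ½t<t , off-axis-¬filled a (half-positive 0<½h))
  where
  open +-*-Solver
  h = ½ ℚ.* ε
  0<h : 0ℚ ℚ.< h
  0<h = half-positive 0<ε
  0<½h : 0ℚ ℚ.< ½ ℚ.* h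
  0<½h = half-positive 0<h
  ½t<t : ½ ℚ.* (½ ℚ.* h) ℚ.< ½ ℚ.* h
  ½t<t = 0<⇒< (half-positive 0<½h) (solve 1 (λ t → con ½ :* t := t :- con ½ :* t) refl (½ ℚ.* h))
  approximation = interval-approximation z z∈ 0<h
  a = proj₁ approximation
  a∈ = proj₁ (proj₂ approximation)

  gap : ∀ {d e s} → d ℚ.* d ℚ.≤ h ℚ.* h → e ℚ.* e ℚ.≤ h ℚ.* h → ε ℚ.* ε ℚ.≤ s →
    (d ℚ.* d ℚ.+ e ℚ.* e) ℚ.+ ½ ℚ.* h ℚ.* (½ ℚ.* h) ℚ.< s
  gap {d} {e} {s} d² e² ε² = 0<⇒<
    -- With h = ε/2 the two squares take at most ε²/2, and the rational margin demanded by strict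
    -- order takes (h/2)² = ε²/16; 7/16 of ε² is left over.
    (0<+0≤ (0<*0< (ℚ.positive⁻¹ (+ 7 ℚ./ 16)) (0<*0< 0<ε 0<ε))
      (0≤+0≤ (0≤+0≤ (≤⇒0≤ d²) (≤⇒0≤ e²)) (≤⇒0≤ ε²)))
    (solve 4 (λ D E s ε → let h = con ½ :* ε in
      con (+ 7 ℚ./ 16) :* (ε :* ε) :+ (((h :* h :- D) :+ (h :* h :- E)) :+ (s :- ε :* ε)) :=
      s :- ((D :+ E) :+ con ½ :* h :* (con ½ :* h))) refl (d ℚ.* d) (e ℚ.* e) s ε)

  near : ∀ {t} → 0ℚ ℚ.≤ t → t ℚ.< ½ ℚ.* h → distance² (rational (a , t)) z < r * r
  near {t} 0≤t t<½h = ½ ℚ.* h ℚ.* (½ ℚ.* h) , 0<*0< 0<½h 0<½h ,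
    eventually-map (λ {n} ((re-close , im-close) , ε<rn) →
      gap {a ℚ.- seq (re z) n} {t ℚ.- seq (im z) n}
        (∣p∣≤q⇒p²≤q² {q = h} (ℚ.<⇒≤ re-close))
        (∣p∣≤q⇒p²≤q² {q = h} (ℚ.<⇒≤ (∣+∣<½+½ {t} {ℚ.- seq (im z) n}
          (subst (ℚ._< ½ ℚ.* h) (sym (ℚ.0≤p⇒∣p∣≡p 0≤t)) t<½h)
          (subst (ℚ._< ½ ℚ.* h) (sym (ℚ.∣-p∣≡∣p∣ (seq (im z) n))) im-close))))
        (square-mono-≤ (ℚ.<⇒≤ 0<ε) (ℚ.<⇒≤ (subst (ℚ._< seq r n) (ℚ.+-identityˡ ε) ε<rn))))
      (both (proj₂ (proj₂ approximation)) ε<r)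

proposition5 :
  (∀ (n : ℕ) (n≥4 : 4 ≤ℕ n) (m : ℕ) →
    let G  = barycentric (cycle n (<⇒≤ n≥4))
        N  = size (G (suc m))
        d  = size (G m)
        TL = T (matrixRawRing N) (laplacian (G (suc m)))
    in 2 *ℕ d ≡ N
       × (Σ[ S ∈ Subspace N ] Σ[ b ∈ Vector (Vector ℝ N) d ]
            (Invariant TL S × IsBasis S b × RestrictsTo TL b (laplacian (G m)))))
  × (∀ (z : ℂ) → Julia (T ℂ-rawRing) z ⇔ realInterval (fromℕ 0) (fromℕ 4) z)
proposition5 =
  (λ n n≥4 m → let E = doubling (barycentric-cyclic (cycle-cyclic n n≥4) m) in
    Doubling.size-doubles E , evenVectors E , evenBasis E ,
    (λ {v} → evenVectors-invariant E {v}) , evenBasis-isBasis E , T-laplacian-restricts E) ,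
  λ z → mk⇔ (julia⇒interval z) (interval⇒julia z)
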